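{- Let $X=\mathbb{N}$ and let $G$ be a group of computable permutations of $X$ such that the $G$-space $(G,X)$ does not satisfy F\o lner's condition. Then there exist a finite subset $K\subset G$ and two families $(A_k)_{k\in K}$, $(B_k)_{k\in K}$ of computable subsets of $X$ such that $$X=\Big(\bigsqcup_{k\in K}k(A_k)\Big)\sqcup\Big(\bigsqcup_{k\in K}k(B_k)\Big)=\bigsqcup_{k\in K}A_k=\bigsqcup_{k\in K}B_k,$$ i.e. $(K,(A_k)_{k\in K},(B_k)_{k\in K})$ is a computable paradoxical decomposition of $X$.
   Context: $\bigsqcup$ denotes a union of pairwise disjoint sets; some of the sets $A_k$, $B_k$ may be empty. For $k\in G$ and $A\subseteq X$, $k(A)$ is the image of $A$ under $k$. $G$ is a group under composition, each of whose elements is a computable permutation of $\mathbb{N}$. For $R\subseteq G$ and $A\subseteq X$ put $$\partial_R A=\{x\in X\setminus A:\ \exists\rho\in R\cup R^{ -1}\ (\rho(x)\in A)\}.$$ The $G$-space $(G,X)$ satisfies F\o lner's condition if for every finite $R\subseteq G$ and every natural number $n\ge1$ there is a finite non-empty $F\subseteq X$ with $|\partial_R F|<\frac1n|F|$. -}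

module Defs where

open import Data.Fin.Base using (Fin)
open import Data.List.Base using (List; []; length; map; _++_)
open import Data.List.Membership.Propositional using () renaming (_∈_ to _∈ₗ_)
open import Data.List.Relation.Unary.All using (All)
open import Data.List.Relation.Unary.Any using (Any)
open import Data.List.Relation.Unary.Unique.Propositional using (Unique)
open import Data.Nat.Base using (ℕ; suc; _*_; _≤_; _<_)
open import Data.Product.Base using (_×_; _,_; ∃-syntax)
open import Data.Sum.Base using (_⊎_; [_,_]′)
open import Data.Vec.Base using (Vec; []; _∷_; lookup)
open import Data.Vec.Relation.Binary.Pointwise.Inductive using (Pointwise)
open import Function.Base using (_∘_)
open import Function.Bundles using (_↔_; _⇔_; module Inverse)
open import Function.Construct.Composition using (_↔-∘_)
open import Function.Construct.Identity using (↔-id)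
open import Function.Construct.Symmetry using (↔-sym)
open import Function.Definitions using (Injective)
open import Level using (Level; 0ℓ)
open import Relation.Binary.PropositionalEquality.Core using (_≡_; _≢_; _≗_)
open import Relation.Unary using (Pred; _∈_; _∉_; ⋃; Universal; _⊥_)

open Inverse using (to)

private
  variable
    i ℓ : Level
    m n : ℕ

-- Codes for partial μ-recursive functions of n arguments.
data Code : ℕ → Set where
  zeroᶜ : Code 0
  sucᶜ  : Code 1
  projᶜ : Fin n → Code n
  compᶜ : Code m → Vec (Code n) m → Code n
  recᶜ  : Code n → Code (suc (suc n)) → Code (suc n)
  minᶜ  : Code (suc n) → Code n

infix 4 _[_]⇓_

data _[_]⇓_ : Code n → Vec ℕ n → ℕ → Set where
  ⇓zero : zeroᶜ [ [] ]⇓ 0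
  ⇓suc  : ∀ {x} → sucᶜ [ x ∷ [] ]⇓ suc x
  ⇓proj : ∀ {k : Fin n} {xs} → projᶜ k [ xs ]⇓ lookup xs k
  ⇓comp : ∀ {c : Code m} {ds : Vec (Code n) m} {xs ys z} →
          Pointwise (λ d y → d [ xs ]⇓ y) ds ys →
          c [ ys ]⇓ z →
          compᶜ c ds [ xs ]⇓ z
  ⇓rec₀ : ∀ {c : Code n} {d xs z} →
          c [ xs ]⇓ z →
          recᶜ c d [ 0 ∷ xs ]⇓ z
  ⇓recₛ : ∀ {c : Code n} {d x xs y z} →
          recᶜ c d [ x ∷ xs ]⇓ y →
          d [ x ∷ y ∷ xs ]⇓ z →
          recᶜ c d [ suc x ∷ xs ]⇓ z
  -- Evaluation must also terminate at every argument below the least zero.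
  ⇓min  : ∀ {c : Code (suc n)} {xs y} →
          (∀ x → x < y → ∃[ v ] c [ x ∷ xs ]⇓ suc v) →
          c [ y ∷ xs ]⇓ 0 →
          minᶜ c [ xs ]⇓ y

Computable : (ℕ → ℕ) → Set
Computable f = ∃[ c ] ∀ x → c [ x ∷ [] ]⇓ f x

_IsCharacteristicOf_ : (ℕ → ℕ) → Pred ℕ ℓ → Set ℓ
χ IsCharacteristicOf A = ∀ x → (x ∈ A × χ x ≡ 1) ⊎ (x ∉ A × χ x ≡ 0)

ComputableSet : Pred ℕ ℓ → Set ℓ
ComputableSet A = ∃[ χ ] Computable χ × χ IsCharacteristicOf A

Perm : Set
Perm = ℕ ↔ ℕ

-- Elements of ℕ ↔ ℕ also carry an inverse and proofs; as permutations
-- they are identified when they agree as functions.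
infix 4 _≈_

_≈_ : Perm → Perm → Set
π ≈ ρ = to π ≗ to ρ

record IsComputablePermGroup (G : Pred Perm ℓ) : Set ℓ where
  field
    resp-≈     : ∀ {π ρ} → π ≈ ρ → π ∈ G → ρ ∈ G
    id-closed  : ↔-id ℕ ∈ G
    ∘-closed   : ∀ {π ρ} → π ∈ G → ρ ∈ G → (π ↔-∘ ρ) ∈ G
    ⁻¹-closed  : ∀ {π} → π ∈ G → ↔-sym π ∈ G
    computable : ∀ {π} → π ∈ G → Computable (to π)

∂ : List Perm → Pred ℕ ℓ → Pred ℕ ℓ
∂ R A x = x ∉ A × Any (λ ρ → to ρ x ∈ A) (R ++ map ↔-sym R)

-- A list without repetitions enumerating P; its length is ∣P∣.
_Enumerates_ : List ℕ → Pred ℕ ℓ → Set ℓ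
xs Enumerates P = Unique xs × (∀ x → x ∈ₗ xs ⇔ x ∈ P)

-- A finite set F ⊆ ℕ is a list without repetitions, and the inequality
-- ∣∂F∣ < (1/n)∣F∣ is multiplied through by n.
Følner : Pred Perm ℓ → Set ℓ
Følner G =
  ∀ (R : List Perm) → All G R → ∀ (n : ℕ) → 1 ≤ n →
  ∃[ F ] Unique F × F ≢ [] ×
  ∃[ ∂F ] ∂F Enumerates ∂ R (_∈ₗ F) × n * length ∂F < length F

image : (ℕ → ℕ) → Pred ℕ ℓ → Pred ℕ ℓ
image f A y = ∃[ x ] x ∈ A × f x ≡ y

-- ℕ is the disjoint union of the family S, whose members may be empty.
record IsPartition {I : Set i} (S : I → Pred ℕ 0ℓ) : Set i where
  field
    covers   : Universal (⋃ I S)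
    disjoint : ∀ {j k} → j ≢ k → S j ⊥ S k

-- The finite set K ⊆ G is listed without repetitions by k, and the
-- families (A_k), (B_k) are indexed by positions in that list.
record IsComputableParadoxicalDecomposition
  (G : Pred Perm ℓ) (k : Fin m → Perm) (A B : Fin m → Pred ℕ 0ℓ) : Set ℓ where
  field
    k∈G          : ∀ j → k j ∈ G
    k-distinct   : Injective _≡_ _≈_ k
    A-computable : ∀ j → ComputableSet (A j)
    B-computable : ∀ j → ComputableSet (B j)
    images       : IsPartition {I = Fin m ⊎ Fin m}
                     [ (λ j → image (to (k j)) (A j))
                     , (λ j → image (to (k j)) (B j)) ]′
    A-partition  : IsPartition A
    B-partition  : IsPartition B

{-# OPTIONS --safe #-}

-- If Følner's condition fails, iterating F ↦ F ∪ ∂F gives a finite K ⊆ G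
-- through which every finite F has at least 4∣F∣ neighbours. Join each of two
-- copies of x to the points k x, k ∈ K; in this locally finite bipartite graph every
-- finite set of vertices, on either side, has at least twice as many
-- neighbours. A paradoxical decomposition is a perfect matching of this graph.
--
-- A computable perfect matching is obtained greedily with a lookahead
-- (after Kierstead). If a finite matching covers everything up to a computable
-- horizon around the part of it to be frozen, then every uncovered vertex u is
-- so far away that the alternating search from u must reach an uncovered vertex:
-- by expansion it outgrows the number of places where frozen edges can block it.
-- So the matching extends, with the frozen part kept, to any further horizon,
-- and such an extension can be found by unbounded search.
module Submission where

open import Defs
open import Axiom.ExcludedMiddle using (ExcludedMiddle)
open import Data.Empty using (⊥-elim)
open import Data.Fin.Base using (Fin; zero; suc; toℕ; fromℕ<)
open import Data.Fin.Patterns using (0F; 1F; 2F; 3F)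
open import Data.Fin.Properties using (toℕ<n; toℕ-fromℕ<; toℕ-injective)
open import Data.List.Base as List
  using (List; []; _∷_; _++_; length; filter; upTo; map; concatMap; deduplicate; cartesianProductWith)
open import Data.List.Membership.DecPropositional using () renaming (_∈?_ to mem?)
open import Data.List.Membership.Propositional using (find; lose) renaming (_∈_ to _∈ₗ_; _∉_ to _∉ₗ_)
open import Data.List.Membership.Propositional.Properties
open import Data.List.Properties using (length-map; length-++; length-upTo; filter-accept; length-filter)
open import Data.List.Relation.Unary.All as All using (All; []; _∷_)
import Data.List.Relation.Unary.All.Properties as All
open import Data.List.Relation.Unary.AllPairs using (AllPairs; []; _∷_)
open import Data.List.Relation.Unary.Any as Any using (Any; here; there)
open import Data.List.Relation.Unary.Any.Properties using (lookup-index)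
open import Data.List.Relation.Unary.Unique.DecPropositional.Properties using (deduplicate-!)
open import Data.List.Relation.Unary.Unique.Propositional using (Unique)
import Data.List.Relation.Unary.Unique.Propositional.Properties as Unique
open import Data.Nat.Base
open import Data.Nat.Divisibility using (divides-refl)
open import Data.Nat.DivMod
open import Data.Nat.Properties
open import Data.Product.Base using (Σ-syntax; ∃-syntax; _×_; _,_; proj₁; proj₂; swap)
open import Data.Product.Properties using (≡-dec)
open import Data.Sum.Base as Sum using (_⊎_; inj₁; inj₂; [_,_]′)
open import Data.Vec.Base using (Vec; []; _∷_; lookup; tabulate)
open import Data.Vec.Properties using (tabulate∘lookup)
open import Data.Vec.Relation.Binary.Pointwise.Inductive using (Pointwise; []; _∷_; tabulate⁺)
open import Function.Base using (_∘_; flip; id)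
open import Function.Bundles using (mk⇔; module Inverse; module Equivalence)
open import Function.Construct.Composition using (_↔-∘_)
open import Function.Construct.Identity using (↔-id)
open import Function.Construct.Symmetry using (↔-sym)
open import Function.Definitions using (Injective)
open import Level using (Level; 0ℓ; Lift; lift; lower)
open import Relation.Binary.PropositionalEquality
open import Relation.Nullary using (Dec; yes; no; contradiction)
open import Relation.Nullary.Decidable using (map′; decidable-stable; _⊎-dec_; ¬?)
open import Relation.Nullary.Negation.Core using (¬_)
open import Relation.Unary using (Pred; Decidable; ∁; _∩_; _∪_; _∈_)

-- Recursive functions and predicates

private variable
  ℓ : Level
  m n : ℕ
  f g : Vec ℕ n → ℕ

Recursive : (Vec ℕ n → ℕ) → Set
Recursive f = ∃[ c ] ∀ xs → c [ xs ]⇓ f xs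

recursive-cong : (∀ xs → f xs ≡ g xs) → Recursive f → Recursive g
recursive-cong eq (c , p) = c , λ xs → subst (c [ xs ]⇓_) (eq xs) (p xs)

var : (i : Fin n) → Recursive (λ xs → lookup xs i)
var i = projᶜ i , λ _ → ⇓proj

comp : Recursive {m} g → {fs : Fin m → Vec ℕ n → ℕ} → (∀ i → Recursive (fs i)) →
       Recursive (λ xs → g (tabulate (λ i → fs i xs)))
comp (c , p) ps =
  compᶜ c (tabulate (proj₁ ∘ ps)) , λ xs → ⇓comp (tabulate⁺ λ i → proj₂ (ps i) xs) (p _)

comp₁ : (g : ℕ → ℕ) → Computable g → Recursive f → Recursive (g ∘ f)
comp₁ _ (c , p) (d , q) = compᶜ c (d ∷ []) , λ xs → ⇓comp (q xs ∷ []) (p _)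

comp₂ : (k : ℕ → ℕ → ℕ) → Recursive (λ xs → k (lookup xs 0F) (lookup xs 1F)) →
        Recursive f → Recursive g → Recursive (λ xs → k (f xs) (g xs))
comp₂ _ (c , p) (d , q) (d′ , q′) =
  compᶜ c (d ∷ d′ ∷ []) , λ xs → ⇓comp (q xs ∷ q′ xs ∷ []) (p _)

unary : {k : ℕ → ℕ} → Recursive (λ xs → k (lookup xs 0F)) → Computable k
unary (c , p) = c , λ x → p (x ∷ [])

const-rec : ∀ k → Recursive {n} (λ _ → k)
const-rec zero    = compᶜ zeroᶜ [] , λ _ → ⇓comp [] ⇓zero
const-rec (suc k) = comp₁ suc (sucᶜ , λ _ → ⇓suc) (const-rec k)

suc-rec : Recursive f → Recursive (suc ∘ f)
suc-rec = comp₁ suc (sucᶜ , λ _ → ⇓suc)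

-- Only the two recursion equations of an already defined `h` have to be checked. The recursion
-- argument `b xs` may depend on the parameters, which are passed on unchanged.
primrec : {h : ℕ → Vec ℕ n → ℕ} →
          Recursive f → Recursive g →
          (∀ xs → f xs ≡ h 0 xs) →
          (∀ x xs → g (x ∷ h x xs ∷ xs) ≡ h (suc x) xs) →
          {b : Vec ℕ n → ℕ} → Recursive b → Recursive (λ xs → h (b xs) xs)
primrec {n} {h = h} (c , p) (d , q) h₀ hₛ {b} (e , r) =
  compᶜ (recᶜ c d) (e ∷ tabulate projᶜ) ,
  λ xs → ⇓comp (r xs ∷ subst (Pointwise _ _) (tabulate∘lookup xs) (tabulate⁺ λ _ → ⇓proj))
                (run (b xs) xs)
  where
  run : ∀ x xs → recᶜ c d [ x ∷ xs ]⇓ h x xs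
  run zero    xs = ⇓rec₀ (subst (c [ xs ]⇓_) (h₀ xs) (p xs))
  run (suc x) xs = ⇓recₛ (run x xs) (subst (d [ _ ]⇓_) (hₛ x xs) (q _))

pred-rec : Recursive f → Recursive (pred ∘ f)
pred-rec = comp₁ pred (unary (primrec {h = λ x _ → pred x} (const-rec 0) (var 0F)
                   (λ _ → refl) (λ _ _ → refl) (var 0F)))

+-rec : Recursive f → Recursive g → Recursive (λ xs → f xs + g xs)
+-rec = comp₂ _+_ (primrec {h = λ x xs → x + lookup xs 1F} (var 1F) (suc-rec (var 1F))
                (λ _ → refl) (λ _ _ → refl) (var 0F))

*-rec : Recursive f → Recursive g → Recursive (λ xs → f xs * g xs)
*-rec = comp₂ _*_ (primrec {h = λ x xs → x * lookup xs 1F} (const-rec 0) (+-rec (var 3F) (var 1F))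
                (λ _ → refl) (λ _ _ → refl) (var 0F))

∸-rec : Recursive f → Recursive g → Recursive (λ xs → f xs ∸ g xs)
∸-rec = comp₂ _∸_ (primrec {h = λ x xs → lookup xs 0F ∸ x} (var 0F) (pred-rec (var 1F))
                (λ _ → refl) (λ x xs → pred[m∸n]≡m∸[1+n] (lookup xs 0F) x) (var 1F))

Σ< Π< : ℕ → (ℕ → ℕ) → ℕ
Σ< zero    t = 0
Σ< (suc b) t = Σ< b t + t b
Π< zero    t = 1
Π< (suc b) t = Π< b t * t b

-- Evaluating at x ∷ xs inside a recursion step, whose context is x ∷ y ∷ xs.
skip : Recursive {suc n} g → Recursive {suc (suc n)} (λ { (x ∷ _ ∷ xs) → g (x ∷ xs) })
skip {g = g} p = recursive-cong (λ { (x ∷ y ∷ xs) → cong (λ ys → g (x ∷ ys)) (tabulate∘lookup xs) })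
                   (comp p {λ { zero xs → lookup xs 0F ; (suc i) xs → lookup xs (suc (suc i)) }}
                           λ { zero → var 0F ; (suc i) → var (suc (suc i)) })

Σ<-rec : Recursive f → Recursive {suc n} g → Recursive (λ xs → Σ< (f xs) (λ i → g (i ∷ xs)))
Σ<-rec {g = g} b p = primrec {h = λ x xs → Σ< x (λ i → g (i ∷ xs))} (const-rec 0)
  (+-rec (var 1F) (skip p)) (λ _ → refl) (λ _ _ → refl) b

Π<-rec : Recursive f → Recursive {suc n} g → Recursive (λ xs → Π< (f xs) (λ i → g (i ∷ xs)))
Π<-rec {g = g} b p = primrec {h = λ x xs → Π< x (λ i → g (i ∷ xs))} (const-rec 1)
  (*-rec (var 1F) (skip p)) (λ _ → refl) (λ _ _ → refl) b

-- The value 0 means true, so that conjunction and ∀ become sums, disjunction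
-- and ∃ become products, and minimisation needs no translation.
record RecursivePred (P : Pred (Vec ℕ n) 0ℓ) : Set where
  field
    χ        : Vec ℕ n → ℕ
    χ-rec    : Recursive χ
    sound    : ∀ {xs} → χ xs ≡ 0 → P xs
    complete : ∀ {xs} → P xs → χ xs ≡ 0

  decide : Decidable P
  decide xs = map′ sound complete (χ xs ≟ 0)

open RecursivePred

private variable
  P Q : Pred (Vec ℕ n) 0ℓ

infixr 7 _∧ᵖ_
infixr 6 _∨ᵖ_
infixr 5 _→ᵖ_

¬ᵖ_ : RecursivePred P → RecursivePred (∁ P)
¬ᵖ p = record
  { χ = λ xs → 1 ∸ χ p xs
  ; χ-rec = ∸-rec (const-rec 1) (χ-rec p)
  ; sound = λ {xs} eq Pxs → contradiction (trans (sym (cong (1 ∸_) (complete p Pxs))) eq) λ ()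
  ; complete = λ {xs} ¬Pxs → m≤n⇒m∸n≡0 (n≢0⇒n>0 (¬Pxs ∘ sound p)) }

_∧ᵖ_ : RecursivePred P → RecursivePred Q → RecursivePred (P ∩ Q)
p ∧ᵖ q = record
  { χ = λ xs → χ p xs + χ q xs
  ; χ-rec = +-rec (χ-rec p) (χ-rec q)
  ; sound = λ {xs} eq → sound p (m+n≡0⇒m≡0 _ eq) , sound q (m+n≡0⇒n≡0 (χ p xs) eq)
  ; complete = λ (Pxs , Qxs) → cong₂ _+_ (complete p Pxs) (complete q Qxs) }

_∨ᵖ_ : RecursivePred P → RecursivePred Q → RecursivePred (P ∪ Q)
p ∨ᵖ q = record
  { χ = λ xs → χ p xs * χ q xs
  ; χ-rec = *-rec (χ-rec p) (χ-rec q)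
  ; sound = λ {xs} eq → Sum.map (sound p) (sound q) (m*n≡0⇒m≡0∨n≡0 (χ p xs) eq)
  ; complete = λ {xs} → [ (λ Pxs → cong (_* χ q xs) (complete p Pxs))
                        , (λ Qxs → trans (cong (χ p xs *_) (complete q Qxs)) (*-zeroʳ (χ p xs))) ]′ }

_→ᵖ_ : RecursivePred P → RecursivePred Q → RecursivePred (λ xs → P xs → Q xs)
p →ᵖ q = record
  { χ = χ ¬p∨q
  ; χ-rec = χ-rec ¬p∨q
  ; sound = λ eq Pxs → [ (λ ¬Pxs → contradiction Pxs ¬Pxs) , (λ Qxs → Qxs) ]′ (sound ¬p∨q eq)
  ; complete = λ {xs} P→Q → complete ¬p∨q (dec⇒ (decide p xs) P→Q) }
  where
  ¬p∨q = (¬ᵖ p) ∨ᵖ q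
  dec⇒ : ∀ {A B : Set} → Dec A → (A → B) → ¬ A ⊎ B
  dec⇒ (yes a) A→B = inj₂ (A→B a)
  dec⇒ (no ¬a) A→B = inj₁ ¬a

_≤ᵖ_ : Recursive f → Recursive g → RecursivePred (λ xs → f xs ≤ g xs)
p ≤ᵖ q = record
  { χ = _ ; χ-rec = ∸-rec p q ; sound = m∸n≡0⇒m≤n ; complete = m≤n⇒m∸n≡0 }

_<ᵖ_ : Recursive f → Recursive g → RecursivePred (λ xs → f xs < g xs)
p <ᵖ q = suc-rec p ≤ᵖ q

_≡ᵖ_ : Recursive f → Recursive g → RecursivePred (λ xs → f xs ≡ g xs)
p ≡ᵖ q = record
  { χ = χ both ; χ-rec = χ-rec both
  ; sound = λ eq → ≤-antisym (proj₁ (sound both eq)) (proj₂ (sound both eq))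
  ; complete = λ eq → complete both (≤-reflexive eq , ≤-reflexive (sym eq)) }
  where both = (p ≤ᵖ q) ∧ᵖ (q ≤ᵖ p)

Σ<-zero : ∀ b {t} → Σ< b t ≡ 0 → ∀ i → i < b → t i ≡ 0
Σ<-zero (suc b) eq i i<1+b with m<1+n⇒m<n∨m≡n i<1+b
... | inj₁ i<b  = Σ<-zero b (m+n≡0⇒m≡0 _ eq) i i<b
... | inj₂ refl = m+n≡0⇒n≡0 (Σ< b _) eq

Σ<-zero⁻ : ∀ b {t} → (∀ i → i < b → t i ≡ 0) → Σ< b t ≡ 0
Σ<-zero⁻ zero    t≡0 = refl
Σ<-zero⁻ (suc b) t≡0 = cong₂ _+_ (Σ<-zero⁻ b λ i → t≡0 i ∘ m<n⇒m<1+n) (t≡0 b ≤-refl)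

Π<-zero : ∀ b {t} → Π< b t ≡ 0 → ∃[ i ] i < b × t i ≡ 0
Π<-zero (suc b) eq with m*n≡0⇒m≡0∨n≡0 (Π< b _) eq
... | inj₂ tb≡0 = b , ≤-refl , tb≡0
... | inj₁ eq′ with i , i<b , ti≡0 ← Π<-zero b eq′ = i , m<n⇒m<1+n i<b , ti≡0

Π<-zero⁻ : ∀ b {t} i → i < b → t i ≡ 0 → Π< b t ≡ 0
Π<-zero⁻ (suc b) {t} i i<1+b ti≡0 with m<1+n⇒m<n∨m≡n i<1+b
... | inj₁ i<b  = cong (_* t b) (Π<-zero⁻ b i i<b ti≡0)
... | inj₂ refl = trans (cong (Π< b t *_) ti≡0) (*-zeroʳ (Π< b t))

∀<ᵖ : Recursive f → RecursivePred {suc n} Q → RecursivePred (λ xs → ∀ i → i < f xs → Q (i ∷ xs))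
∀<ᵖ {f = f} b q = record
  { χ = _ ; χ-rec = Σ<-rec b (χ-rec q)
  ; sound = λ {xs} eq i i<b → sound q {i ∷ xs} (Σ<-zero (f xs) eq i i<b)
  ; complete = λ {xs} all → Σ<-zero⁻ (f xs) λ i i<b → complete q (all i i<b) }

∃<ᵖ : Recursive f → RecursivePred {suc n} Q → RecursivePred (λ xs → ∃[ i ] i < f xs × Q (i ∷ xs))
∃<ᵖ {f = f} b q = record
  { χ = _ ; χ-rec = Π<-rec b (χ-rec q)
  ; sound = λ {xs} eq → let i , i<b , eq′ = Π<-zero (f xs) eq in i , i<b , sound q {i ∷ xs} eq′
  ; complete = λ {xs} (i , i<b , Qi) → Π<-zero⁻ (f xs) i i<b (complete q {i ∷ xs} Qi) }

-- A large predicate such as `Valid` is built once, for two variables, and then reused with other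
-- arguments.
subst₂ᵖ : {P : ℕ → ℕ → Set} → RecursivePred (λ xs → P (lookup xs 0F) (lookup xs 1F)) →
          Recursive f → Recursive g → RecursivePred (λ xs → P (f xs) (g xs))
subst₂ᵖ p q r = record
  { χ = λ xs → χ p (_ ∷ _ ∷ [])
  ; χ-rec = comp₂ (λ x y → χ p (x ∷ y ∷ []))
                  (recursive-cong (λ { (_ ∷ _ ∷ []) → refl }) (χ-rec p)) q r
  ; sound = sound p ; complete = complete p }

least-zero : ∀ (t : ℕ → ℕ) x → t x ≡ 0 → ∃[ y ] t y ≡ 0 × ∀ z → z < y → t z ≢ 0
least-zero t x eq with t 0 ≟ 0
... | yes t0≡0 = 0 , t0≡0 , λ _ ()
least-zero t zero    eq | no t0≢0 = contradiction eq t0≢0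
least-zero t (suc x) eq | no t0≢0 with y , ty≡0 , min ← least-zero (t ∘ suc) x eq =
  suc y , ty≡0 , λ { zero _ → t0≢0 ; (suc z) (s≤s z<y) → min z z<y }

-- The hypothesis `ex` only makes the search end. The value is the least zero of a recursive
-- function, so it is recursive however the witnesses were obtained.
minimise : RecursivePred {suc n} P → (∀ xs → ∃[ x ] P (x ∷ xs)) →
           Σ[ h ∈ (Vec ℕ n → ℕ) ] Recursive h × (∀ xs → P (h xs ∷ xs))
minimise p ex =
  (λ xs → proj₁ (least xs)) ,
  (minᶜ (proj₁ (χ-rec p)) , λ xs →
    let y , zero-at , min = least xs in
    ⇓min (λ z z<y → _ , subst (_ [ _ ]⇓_) (sym (suc-pred _ {{≢-nonZero (min z z<y)}})) (proj₂ (χ-rec p) _))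
         (subst (proj₁ (χ-rec p) [ y ∷ xs ]⇓_) zero-at (proj₂ (χ-rec p) (y ∷ xs)))) ,
  λ xs → sound p {_ ∷ xs} (proj₁ (proj₂ (least xs)))
  where
  least = λ xs → least-zero (λ x → χ p (x ∷ xs)) (proj₁ (ex xs)) (complete p {_ ∷ xs} (proj₂ (ex xs)))

-- Augmenting finite matchings

-- By induction on `xs`: the element assigned to the head is cut out of `zs`, and by injectivity no
-- later element was assigned to it.
pigeonhole : ∀ {a b r} {A : Set a} {B : Set b} (_∼_ : A → B → Set r) {xs zs} → Unique xs →
             (∀ {x} → x ∈ₗ xs → ∃[ z ] z ∈ₗ zs × x ∼ z) →
             (∀ {x x′ z} → x ∼ z → x′ ∼ z → x ≡ x′) → length xs ≤ length zs
pigeonhole _∼_ [] assign inj = z≤n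
pigeonhole _∼_ {zs = zs} (x∉xs ∷ xs!) assign inj
  with z , z∈zs , x∼z ← assign (here refl)
  with ys , ws , refl ← ∈-∃++ z∈zs =
  subst (suc _ ≤_) (sym length-zs) (s≤s (pigeonhole _∼_ xs! rest inj))
  where
  length-zs : length zs ≡ suc (length (ys ++ ws))
  length-zs = trans (length-++ ys) (trans (+-suc _ _) (cong suc (sym (length-++ ys))))
  rest : ∀ {x′} → x′ ∈ₗ _ → ∃[ z′ ] z′ ∈ₗ ys ++ ws × x′ ∼ z′
  rest x′∈xs with z′ , z′∈zs , x′∼z′ ← assign (there x′∈xs) with ∈-++⁻ ys z′∈zs
  ... | inj₁ z′∈ys         = z′ , ∈-++⁺ˡ z′∈ys , x′∼z′
  ... | inj₂ (there z′∈ws) = z′ , ∈-++⁺ʳ ys z′∈ws , x′∼z′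
  ... | inj₂ (here refl)   = contradiction (inj x∼z x′∼z′) (All.lookup x∉xs x′∈xs)

Edge : Set
Edge = ℕ × ℕ

Lft Rgt : List Edge → ℕ → Set
Lft M u = ∃[ y ] (u , y) ∈ₗ M
Rgt M y = ∃[ u ] (u , y) ∈ₗ M

Lft? : ∀ M u → Dec (Lft M u)
Lft? M u = map′ from to (Any.any? (λ e → proj₁ e ≟ u) M)
  where
  from : Any (λ e → proj₁ e ≡ u) M → Lft M u
  from p with (_ , y) , e , refl ← find p = y , e
  to : Lft M u → Any (λ e → proj₁ e ≡ u) M
  to (_ , e) = lose e refl

Rgt? : ∀ M y → Dec (Rgt M y)
Rgt? M y = map′ from to (Any.any? (λ e → proj₂ e ≟ y) M)
  where
  from : Any (λ e → proj₂ e ≡ y) M → Rgt M y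
  from p with (u , _) , e , refl ← find p = u , e
  to : Rgt M y → Any (λ e → proj₂ e ≡ y) M
  to (_ , e) = lose e refl

record IsMatching (Adj : ℕ → ℕ → Set) (M : List Edge) : Set where
  field
    adj : ∀ {u y} → (u , y) ∈ₗ M → Adj u y
    functional : ∀ {u y z} → (u , y) ∈ₗ M → (u , z) ∈ₗ M → y ≡ z
    injective  : ∀ {u v y} → (u , y) ∈ₗ M → (v , y) ∈ₗ M → u ≡ v

open IsMatching

Expands : (ℕ → ℕ → Set) → Set
Expands Adj = ∀ F → Unique F →
  ∃[ H ] Unique H × (∀ {y} → y ∈ₗ H → ∃[ v ] v ∈ₗ F × Adj v y) × 2 * length F ≤ length H

-- Alternating paths re-match vertices, so in general only coverage survives. Asking for both ends
-- below `w` treats the two sides alike, so that the sides can be exchanged.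
record Extends (w : ℕ) (M M′ : List Edge) : Set where
  field
    left  : ∀ {u} → Lft M u → Lft M′ u
    right : ∀ {y} → Rgt M y → Rgt M′ y
    below : ∀ {u y} → u < w → y < w → (u , y) ∈ₗ M → (u , y) ∈ₗ M′

open Extends

extends-refl : ∀ {w M} → Extends w M M
extends-refl = record { left = id ; right = id ; below = λ _ _ → id }

extends-trans : ∀ {w M M′ M″} → Extends w M M′ → Extends w M′ M″ → Extends w M M″
extends-trans p q = record
  { left  = left q ∘ left p
  ; right = right q ∘ right p
  ; below = λ u<w y<w → below q u<w y<w ∘ below p u<w y<w }

-- Each level applies `β` twice because a step of the alternating search crosses two edges: from a
-- left vertex to a neighbour and on to its partner.
level : (ℕ → ℕ) → ℕ → ℕ → ℕ
level β w zero    = w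
level β w (suc i) = β (β (level β w i))

module Augment
  (Adj : ℕ → ℕ → Set) (nb : ℕ → List ℕ)
  (nb⁻ : ∀ {u y} → y ∈ₗ nb u → Adj u y) (nb⁺ : ∀ {u y} → Adj u y → y ∈ₗ nb u)
  (expands : Expands Adj)
  (β : ℕ → ℕ) (β-inflationary : ∀ w → w ≤ β w)
  (β-right : ∀ {u y w} → Adj u y → β w ≤ u → w ≤ y)
  (β-left  : ∀ {u y w} → Adj u y → β w ≤ y → w ≤ u)
  (w : ℕ)
  where

  private
    lev : ℕ → ℕ
    lev = level β w

    lev-≥w : ∀ i → w ≤ lev i
    lev-≥w zero    = ≤-refl
    lev-≥w (suc i) = ≤-trans (lev-≥w i) (≤-trans (β-inflationary _) (β-inflationary _))

    lev-mono : ∀ i j → lev i ≤ lev (i + j)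
    lev-mono i zero    = ≤-reflexive (cong lev (sym (+-identityʳ i)))
    lev-mono i (suc j) = ≤-trans (lev-mono i j) (≤-trans (β-inflationary _)
      (≤-trans (β-inflationary _) (≤-reflexive (cong lev (sym (+-suc i j))))))

  module _ {M} (M-matching : IsMatching Adj M) {u} (u∉M : ¬ Lft M u) (u-far : lev w ≤ u) where

    -- The result of moving the uncovered vertex u to v along an alternating
    -- path whose left vertices all lie in L.
    record Shift (L : List ℕ) (v : ℕ) : Set where
      field
        {N}      : List Edge
        matching : IsMatching Adj N
        v∉N      : ¬ Lft N v
        left⁺    : ∀ {a} → a ≡ u ⊎ Lft M a → a ≡ v ⊎ Lft N a
        right⁺   : ∀ {y} → Rgt M y → Rgt N y
        right⁻   : ∀ {y} → Rgt N y → Rgt M y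
        below⁺   : ∀ {a y} → y < w → (a , y) ∈ₗ M → (a , y) ∈ₗ N
        kept     : ∀ {a y} → (a , y) ∈ₗ M → (a , y) ∈ₗ N ⊎ a ∈ₗ L

    open Shift

    start : Shift (u ∷ []) u
    start = record
      { matching = M-matching ; v∉N = u∉M ; left⁺ = id ; right⁺ = id ; right⁻ = id
      ; below⁺ = λ _ → id ; kept = inj₁ }

    Result : Set
    Result = ∃[ M′ ] IsMatching Adj M′ × Extends w M M′ × Lft M′ u

    -- The shifted matching misses `v` and, by `right⁻`, also `y`, so the edge between them can be
    -- added. Then `left⁺` shows that `u` is covered as well.
    finish : ∀ {L v y} → Shift L v → Adj v y → ¬ Rgt M y → Result
    finish {v = v} {y} s v~y y∉M = (v , y) ∷ N s , matching′ , extends′ , cover (inj₁ refl)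
      where
      cover : ∀ {a} → a ≡ u ⊎ Lft M a → Lft ((v , y) ∷ N s) a
      cover p with left⁺ s p
      ... | inj₁ refl    = y , here refl
      ... | inj₂ (z , ∈) = z , there ∈
      matching′ : IsMatching Adj ((v , y) ∷ N s)
      adj matching′ (here refl) = v~y
      adj matching′ (there e)   = adj (matching s) e
      functional matching′ (here refl) (here refl) = refl
      functional matching′ (here refl) (there e)   = contradiction (_ , e) (v∉N s)
      functional matching′ (there e)   (here refl) = contradiction (_ , e) (v∉N s)
      functional matching′ (there e)   (there e′)  = functional (matching s) e e′
      injective matching′ (here refl) (here refl) = refl
      injective matching′ (here refl) (there e)   = contradiction (right⁻ s (_ , e)) y∉M
      injective matching′ (there e)   (here refl) = contradiction (right⁻ s (_ , e)) y∉M
      injective matching′ (there e)   (there e′)  = injective (matching s) e e′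
      extends′ : Extends w M ((v , y) ∷ N s)
      left  extends′ = cover ∘ inj₂
      right extends′ p = let a , ∈ = right⁺ s p in a , there ∈
      below extends′ _ y<w e = there (below⁺ s y<w e)

    -- Replacing the edge from `a` to `y` by one from `v` to `y` moves the hole from `v` to `a`.
    -- That edge is still present by `kept`, since `a` has not been reached before, and it is not
    -- frozen, since `w ≤ y`.
    push : ∀ {L v y a} → Shift (u ∷ L) v → Adj v y → w ≤ y → (a , y) ∈ₗ M → a ∉ₗ u ∷ L →
           Shift (u ∷ a ∷ L) a
    push {L} {v} {y} {a} s v~y w≤y ay∈M a∉L = record
      { N = N′ ; matching = matching′ ; v∉N = a∉N′
      ; left⁺ = λ p → left′ (left⁺ s p)
      ; right⁺ = right′ ∘ right⁺ s
      ; right⁻ = λ { (_ , here refl) → _ , ay∈M ; (_ , there e) → right⁻ s (_ , old e) }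
      ; below⁺ = λ z<w e → there (∈-filter⁺ ≢y? (below⁺ s z<w e) λ { refl → <⇒≱ z<w w≤y })
      ; kept = kept′ }
      where
      ≢y? = λ (e : Edge) → ¬? (proj₂ e ≟ y)
      N′ = (v , y) ∷ filter ≢y? (N s)
      old : ∀ {e} → e ∈ₗ filter ≢y? (N s) → e ∈ₗ N s
      old = proj₁ ∘ ∈-filter⁻ ≢y?
      ≢y : ∀ {e} → e ∈ₗ filter ≢y? (N s) → proj₂ e ≢ y
      ≢y = proj₂ ∘ ∈-filter⁻ ≢y? {xs = N s}
      ay∈N : (a , y) ∈ₗ N s
      ay∈N = [ id , (λ a∈L → contradiction a∈L a∉L) ]′ (kept s ay∈M)
      matching′ : IsMatching Adj N′
      adj matching′ (here refl) = v~y
      adj matching′ (there e)   = adj (matching s) (old e)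
      functional matching′ (here refl) (here refl) = refl
      functional matching′ (here refl) (there e)   = contradiction (_ , old e) (v∉N s)
      functional matching′ (there e)   (here refl) = contradiction (_ , old e) (v∉N s)
      functional matching′ (there e)   (there e′)  = functional (matching s) (old e) (old e′)
      injective matching′ (here refl) (here refl) = refl
      injective matching′ (here refl) (there e)   = contradiction refl (≢y e)
      injective matching′ (there e)   (here refl) = contradiction refl (≢y e)
      injective matching′ (there e)   (there e′)  = injective (matching s) (old e) (old e′)
      a∉N′ : ¬ Lft N′ a
      a∉N′ (_ , here refl) = v∉N s (_ , ay∈N)
      a∉N′ (_ , there e)   = ≢y e (functional (matching s) (old e) ay∈N)
      left′ : ∀ {b} → b ≡ v ⊎ Lft (N s) b → b ≡ a ⊎ Lft N′ b
      left′ (inj₁ refl) = inj₂ (y , here refl)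
      left′ (inj₂ (z , e)) with z ≟ y
      ... | yes refl = inj₁ (injective (matching s) e ay∈N)
      ... | no z≢y   = inj₂ (z , there (∈-filter⁺ ≢y? e z≢y))
      right′ : ∀ {z} → Rgt (N s) z → Rgt N′ z
      right′ {z} (b , e) with z ≟ y
      ... | yes refl = v , here refl
      ... | no z≢y   = b , there (∈-filter⁺ ≢y? e z≢y)
      kept′ : ∀ {b z} → (b , z) ∈ₗ M → (b , z) ∈ₗ N′ ⊎ b ∈ₗ u ∷ a ∷ L
      kept′ {b} {z} e with z ≟ y
      ... | yes refl = inj₂ (there (here (injective M-matching e ay∈M)))
      ... | no z≢y with kept s e
      ...   | inj₁ e′          = inj₁ (there (∈-filter⁺ ≢y? e′ z≢y))
      ...   | inj₂ (here eq)   = inj₂ (here eq)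
      ...   | inj₂ (there b∈L) = inj₂ (there (there b∈L))

    -- The search never uses a right vertex below `w`, whose edge may be frozen, and gains nothing
    -- from one whose partner is already in `L`.
    Blocked : List ℕ → ℕ → Set
    Blocked L y = y < w ⊎ ∃[ a ] a ∈ₗ L × (a , y) ∈ₗ M

    blocked? : ∀ L y → Dec (Blocked L y)
    blocked? L y = (y <? w) ⊎-dec
      map′ (λ p → let a , a∈L , e = find p in a , a∈L , e) (λ (_ , a∈L , e) → lose a∈L e)
           (Any.any? (λ a → mem? (≡-dec _≟_ _≟_) (a , y) M) L)

    -- If nothing new is reachable then the reached vertices at level i + 1
    -- have all their neighbours matched to reached vertices at level i other
    -- than u. So there are more than w reached vertices, whereas expansion
    -- of the whole reached set allows fewer than w.
    not-stuck : ∀ {L} → Unique (u ∷ L) → ¬ (∀ {v y} → v ∈ₗ u ∷ L → Adj v y → Blocked L y)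
    not-stuck {L} uL! blocked = <-irrefl refl (<-≤-trans (≤-trans (layers 0 w refl) (length-filter (lev 0 ≤?_) (u ∷ L))) few)
      where
      open ≤-Reasoning
      few : suc (length L) ≤ w
      few with H , H! , H⊆ , size ← expands (u ∷ L) uL! = +-cancelʳ-≤ (length L) _ _ (begin
        suc (length L) + length L          ≤⟨ +-monoʳ-≤ (suc (length L)) (≤-trans (n≤1+n _) (m≤m+n _ 0)) ⟩
        2 * suc (length L)                 ≤⟨ size ⟩
        length H                           ≤⟨ pigeonhole _∼_ H! assign
                                                (λ { {z = inj₁ _} p q → trans p (sym q) ; {z = inj₂ _} p q → functional M-matching p q }) ⟩
        length targets                     ≡⟨ length-++ (map inj₁ (upTo w)) ⟩
        length (map inj₁ (upTo w)) + length (map inj₂ L) ≡⟨ cong₂ _+_ (trans (length-map inj₁ (upTo w)) (length-upTo w)) (length-map inj₂ L) ⟩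
        w + length L                       ∎)
        where
        -- A neighbour below `w` is charged to itself, any other to its reached partner. As `u` is
        -- unmatched, only the members of `L` occur as partners.
        targets : List (ℕ ⊎ ℕ)
        targets = map inj₁ (upTo w) ++ map inj₂ L
        _∼_ : ℕ → ℕ ⊎ ℕ → Set
        y ∼ inj₁ z = y ≡ z
        y ∼ inj₂ a = (a , y) ∈ₗ M
        assign : ∀ {y} → y ∈ₗ _ → ∃[ z ] z ∈ₗ targets × y ∼ z
        assign y∈H with v , v∈L , v~y ← H⊆ y∈H with blocked v∈L v~y
        ... | inj₁ y<w           = inj₁ _ , ∈-++⁺ˡ (∈-map⁺ inj₁ (∈-upTo⁺ y<w)) , refl
        ... | inj₂ (a , a∈L , e) = inj₂ a , ∈-++⁺ʳ (map inj₁ (upTo w)) (∈-map⁺ inj₂ a∈L) , e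

      layer : ℕ → List ℕ
      layer i = filter (lev i ≤?_) (u ∷ L)

      layers : ∀ i j → i + j ≡ w → suc j ≤ length (layer i)
      layers i zero refl = ≤-trans (s≤s z≤n) (≤-reflexive (cong length (sym (filter-accept (lev i ≤?_)
        (≤-trans (≤-reflexive (cong lev (sym (+-identityʳ i)))) u-far)))))
      layers i (suc j) eq with H , H! , H⊆ , size ← expands (layer (suc i)) (Unique.filter⁺ (lev (suc i) ≤?_) uL!) = begin
        suc (suc j)                              ≤⟨ s≤s (layers (suc i) j (trans (sym (+-suc i j)) eq)) ⟩
        suc (length (layer (suc i)))             ≤⟨ s≤s (m≤m+n _ _) ⟩
        suc (2 * length (layer (suc i)))         ≤⟨ s≤s size ⟩
        suc (length H)                           ≤⟨ s≤s (pigeonhole (λ y a → (a , y) ∈ₗ M) H! assign (functional M-matching)) ⟩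
        -- The partners counted all lie in `L`; putting `u` back gives one more vertex for each
        -- level descended.
        suc (length (filter (lev i ≤?_) L))      ≡⟨ cong length (filter-accept (lev i ≤?_) u≥) ⟨
        length (layer i)                         ∎
        where
        u≥ : lev i ≤ u
        u≥ = ≤-trans (lev-mono i (suc j)) (≤-trans (≤-reflexive (cong lev eq)) u-far)
        assign : ∀ {y} → y ∈ₗ H → ∃[ a ] a ∈ₗ filter (lev i ≤?_) L × (a , y) ∈ₗ M
        assign y∈H with v , v∈ , v~y ← H⊆ y∈H
          with v∈L , v≥ ← ∈-filter⁻ (lev (suc i) ≤?_) {xs = u ∷ L} v∈
          with y≥ ← β-right v~y v≥
          with blocked v∈L v~y
        ... | inj₁ y<w = contradiction (≤-trans (lev-≥w i) (≤-trans (β-inflationary _) y≥)) (<⇒≱ y<w)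
        ... | inj₂ (a , a∈L , e) = a , ∈-filter⁺ (lev i ≤?_) a∈L (β-left (adj M-matching e) y≥) , e

    -- The vertices of `L` are distinct left ends of edges of `M`, so there are at most `length M`
    -- of them and the fuel cannot run out. By `not-stuck` some reached vertex has an unblocked
    -- neighbour, which is either free or brings its partner into `L`.
    search : ∀ fuel L → length M < length L + fuel → Unique (u ∷ L) →
             (∀ {a} → a ∈ₗ L → Lft M a) → (∀ {v} → v ∈ₗ u ∷ L → Shift (u ∷ L) v) → Result
    search zero L big (_ ∷ L!) L⊆M _ = contradiction
      (pigeonhole (λ a e → a ≡ proj₁ e) L! (λ a∈L → let y , e = L⊆M a∈L in _ , e , refl)
        λ p q → trans p (sym q))
      (<⇒≱ (subst (length M <_) (+-identityʳ _) big))
    search (suc fuel) L big uL! L⊆M shifts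
      with All.all? (λ v → All.all? (blocked? L) (nb v)) (u ∷ L)
    ... | yes all = ⊥-elim (not-stuck uL!
      λ v∈L v~y → All.lookup (All.lookup all v∈L) (nb⁺ v~y))
    ... | no ¬all
      with v , v∈L , ¬all-v ← find (All.¬All⇒Any¬ (λ v → All.all? (blocked? L) (nb v)) (u ∷ L) ¬all)
      with y , y∈nb , ¬blocked ← find (All.¬All⇒Any¬ (blocked? L) (nb v) ¬all-v)
      with Rgt? M y
    ...   | no y∉M = finish (shifts v∈L) (nb⁻ y∈nb) y∉M
    ...   | yes (a , e) = search fuel (a ∷ L)
      (subst (length M <_) (+-suc (length L) fuel) big)
      (uaL! uL!)
      (λ { (here refl) → y , e ; (there b∈L) → L⊆M b∈L })
      (λ { (here refl) → enlarge (shifts (here refl))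
         ; (there (here refl)) → push (shifts v∈L) (nb⁻ y∈nb) (≮⇒≥ (¬blocked ∘ inj₁)) e a∉uL
         ; (there (there b∈L)) → enlarge (shifts (there b∈L)) })
      where
      enlarge : ∀ {b} → Shift (u ∷ L) b → Shift (u ∷ a ∷ L) b
      enlarge s = record
        { matching = matching s ; v∉N = v∉N s ; left⁺ = left⁺ s ; right⁺ = right⁺ s
        ; right⁻ = right⁻ s ; below⁺ = below⁺ s
        ; kept = λ e → [ inj₁ , (λ { (here eq) → inj₂ (here eq) ; (there p) → inj₂ (there (there p)) }) ]′ (kept s e) }
      a∉uL : a ∉ₗ u ∷ L
      a∉uL (here refl)  = u∉M (y , e)
      a∉uL (there a∈L) = ¬blocked (inj₂ (a , a∈L , e))
      uaL! : Unique (u ∷ L) → Unique (u ∷ a ∷ L)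
      uaL! (u∉L ∷ L!) = ((λ { refl → a∉uL (here refl) }) ∷ u∉L) ∷
                        All.¬Any⇒All¬ L (a∉uL ∘ there) ∷ L!

    augment : Result
    augment = search (suc (length M)) [] ≤-refl ([] ∷ []) (λ ())
                (λ { (here refl) → start })

  -- Vertices are covered in increasing order. One that is still missed lies at or beyond `lev w`,
  -- since everything below was covered and coverage is never lost; hence `augment` applies.
  cover : ∀ {M} → IsMatching Adj M → (∀ {u} → u < lev w → Lft M u) → ∀ b →
          ∃[ M′ ] IsMatching Adj M′ × Extends w M M′ × (∀ {u} → u < b → Lft M′ u)
  cover {M} M-matching covered zero = M , M-matching , extends-refl , λ ()
  cover M-matching covered (suc b)
    with M₁ , M₁-matching , ext , covered₁ ← cover M-matching covered b
    with Lft? M₁ b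
  ... | yes b∈M₁ = M₁ , M₁-matching , ext , λ u<1+b →
    [ covered₁ , (λ { refl → b∈M₁ }) ]′ (m<1+n⇒m<n∨m≡n u<1+b)
  ... | no b∉M₁
    with M₂ , M₂-matching , ext′ , b∈M₂ ←
           augment M₁-matching b∉M₁ (≮⇒≥ (b∉M₁ ∘ left ext ∘ covered)) =
    M₂ , M₂-matching , extends-trans ext ext′ , λ u<1+b →
      [ left ext′ ∘ covered₁ , (λ { refl → b∈M₂ }) ]′ (m<1+n⇒m<n∨m≡n u<1+b)

-- Covering both sides of the graph

swap-∈⁺ : ∀ {M : List Edge} {u y} → (u , y) ∈ₗ M → (y , u) ∈ₗ map swap M
swap-∈⁺ = ∈-map⁺ swap

swap-∈⁻ : ∀ {M : List Edge} {u y} → (y , u) ∈ₗ map swap M → (u , y) ∈ₗ M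
swap-∈⁻ e with _ , e′ , refl ← ∈-map⁻ swap e = e′

transpose : ∀ {Adj M} → IsMatching Adj M → IsMatching (flip Adj) (map swap M)
adj        (transpose p) e    = adj p (swap-∈⁻ e)
functional (transpose p) e e′ = injective p (swap-∈⁻ e) (swap-∈⁻ e′)
injective  (transpose p) e e′ = functional p (swap-∈⁻ e) (swap-∈⁻ e′)

module Cover
  (Adj : ℕ → ℕ → Set) (nbˡ nbʳ : ℕ → List ℕ)
  (nbˡ⁻ : ∀ {u y} → y ∈ₗ nbˡ u → Adj u y) (nbˡ⁺ : ∀ {u y} → Adj u y → y ∈ₗ nbˡ u)
  (nbʳ⁻ : ∀ {u y} → u ∈ₗ nbʳ y → Adj u y) (nbʳ⁺ : ∀ {u y} → Adj u y → u ∈ₗ nbʳ y)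
  (expandsˡ : Expands Adj) (expandsʳ : Expands (flip Adj))
  (β : ℕ → ℕ) (β-inflationary : ∀ w → w ≤ β w)
  (β-right : ∀ {u y w} → Adj u y → β w ≤ u → w ≤ y)
  (β-left  : ∀ {u y w} → Adj u y → β w ≤ y → w ≤ u)
  where

  -- The right side is covered second, by `cover` in the transposed graph, where `β-left` and
  -- `β-right` change places. The left coverage survives as the `right` field of that extension.
  cover-both : ∀ w {M} → IsMatching Adj M →
    (∀ {u} → u < level β w w → Lft M u) → (∀ {y} → y < level β w w → Rgt M y) → ∀ b →
    ∃[ M′ ] IsMatching Adj M′ × Extends w M M′ ×
            (∀ {u} → u < b → Lft M′ u) × (∀ {y} → y < b → Rgt M′ y)
  cover-both w M-matching coveredˡ coveredʳ b
    with M₁ , M₁-matching , ext , covered₁ ←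
           Augment.cover Adj nbˡ nbˡ⁻ nbˡ⁺ expandsˡ β β-inflationary β-right β-left w M-matching coveredˡ b
    with M₂ , M₂-matching , ext′ , covered₂ ←
           Augment.cover (flip Adj) nbʳ nbʳ⁻ nbʳ⁺ expandsʳ β β-inflationary β-left β-right w (transpose M₁-matching)
             (λ y<w → let u , e = right ext (coveredʳ y<w) in u , swap-∈⁺ e) b =
    map swap M₂ , transpose M₂-matching ,
    extends-trans ext (record
      { left  = λ (y , e) → let z , e′ = right ext′ (y , swap-∈⁺ e) in z , swap-∈⁺ e′
      ; right = λ (u , e) → let z , e′ = left ext′ (u , swap-∈⁺ e) in z , swap-∈⁺ e′
      ; below = λ u<w y<w e → swap-∈⁺ (below ext′ y<w u<w (swap-∈⁺ e)) }) ,
    (λ u<b → let y , e = covered₁ u<b ; z , e′ = right ext′ (y , swap-∈⁺ e) in z , swap-∈⁺ e′) ,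
    (λ y<b → let u , e = covered₂ y<b in u , swap-∈⁺ e)

-- Effective Hall theorem

-- A numerical index makes the family a single recursive function of two arguments. Indices out of
-- range give the default value 0.
apply : ∀ {k} → (Fin k → ℕ → ℕ) → ℕ → ℕ → ℕ
apply {zero}  e _       u = 0
apply {suc k} e zero    u = e zero u
apply {suc k} e (suc d) u = apply (e ∘ suc) d u

apply-toℕ : ∀ {k} (e : Fin k → ℕ → ℕ) i u → apply e (toℕ i) u ≡ e i u
apply-toℕ e zero    u = refl
apply-toℕ e (suc i) u = apply-toℕ (e ∘ suc) i u

apply-rec : ∀ {k} {e : Fin k → ℕ → ℕ} → (∀ i → Computable (e i)) →
            Recursive {2} (λ xs → apply e (lookup xs 0F) (lookup xs 1F))
apply-rec {zero}      c = const-rec 0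
apply-rec {suc k} {e} c = primrec {h = λ d xs → apply e d (lookup xs 1F)}
  (comp₁ (e zero) (c zero) (var 1F))
  (comp₂ (apply (e ∘ suc)) (apply-rec (c ∘ suc)) (var 0F) (var 3F))
  (λ _ → refl) (λ _ _ → refl) (var 0F)

total : ∀ {k} → (Fin k → ℕ → ℕ) → ℕ → ℕ
total {zero}  e u = 0
total {suc k} e u = e zero u + total (e ∘ suc) u

≤-total-sum : ∀ {k} (e : Fin k → ℕ → ℕ) i u → e i u ≤ total e u
≤-total-sum e zero    u = m≤m+n _ _
≤-total-sum e (suc i) u = ≤-trans (≤-total-sum (e ∘ suc) i u) (m≤n+m _ _)

total-rec : ∀ {k} {e : Fin k → ℕ → ℕ} → (∀ i → Computable (e i)) → Recursive {1} (λ xs → total e (lookup xs 0F))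
total-rec {zero}      c = const-rec 0
total-rec {suc k} {e} c = +-rec (comp₁ (e zero) (c zero) (var 0F)) (total-rec (c ∘ suc))

≤-Σ< : ∀ b t {z} → z < b → t z ≤ Σ< b t
≤-Σ< (suc b) t z<1+b with m<1+n⇒m<n∨m≡n z<1+b
... | inj₁ z<b  = ≤-trans (≤-Σ< b t z<b) (m≤m+n _ _)
... | inj₂ refl = m≤n+m _ _

-- A natural number read in base B is a finitely supported sequence of digits.
module Digits (b : ℕ) where

  -- A base of at least 2 makes division decrease every positive number. For `b = m` the digits are
  -- one for each of `suc m` edge maps and one for an unmatched vertex.
  B : ℕ
  B = 2 + b

  shift : ℕ → ℕ → ℕ
  shift zero    c = c
  shift (suc u) c = shift u c / B

  digit : ℕ → ℕ → ℕ
  digit c u = shift u c % B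

  digit<B : ∀ c u → digit c u < B
  digit<B c u = m%n<n (shift u c) B

  shift-comm : ∀ u c → shift (suc u) c ≡ shift u (c / B)
  shift-comm zero    c = refl
  shift-comm (suc u) c = cong (_/ B) (shift-comm u c)

  shift-≤ : ∀ u c → shift u c ≤ c ∸ u
  shift-≤ zero    c = ≤-refl
  shift-≤ (suc u) c = ≤-trans (/B≤pred (shift u c))
    (≤-trans (pred-mono-≤ (shift-≤ u c)) (≤-reflexive (pred[m∸n]≡m∸[1+n] c u)))
    where
    /B≤pred : ∀ x → x / B ≤ pred x
    /B≤pred zero    = z≤n
    /B≤pred (suc x) = s≤s⁻¹ (m/n<m (suc x) B (s≤s (s≤s z≤n)))

  -- This lets a code serve as the bound for quantifiers over its own matched vertices, which keeps
  -- `Valid` and `Agree` recursive.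
  digit-support : ∀ c u → digit c u ≢ 0 → u < c
  digit-support c u d≢0 = ≰⇒> λ c≤u → d≢0 (cong (_% B)
    (n≤0⇒n≡0 (≤-trans (shift-≤ u c) (≤-reflexive (m≤n⇒m∸n≡0 c≤u)))))

  encode : (ℕ → ℕ) → ℕ → ℕ
  encode d zero    = 0
  encode d (suc k) = d 0 + encode (d ∘ suc) k * B

  digit-encode : ∀ d k → (∀ u → d u < B) → (∀ u → k ≤ u → d u ≡ 0) → ∀ u → digit (encode d k) u ≡ d u
  digit-encode d zero d<B d≡0 u = trans
    (cong (_% B) (n≤0⇒n≡0 (≤-trans (shift-≤ u 0) (≤-reflexive (0∸n≡0 u))))) (sym (d≡0 u z≤n))
  digit-encode d (suc k) d<B d≡0 zero =
    trans ([m+kn]%n≡m%n (d 0) (encode (d ∘ suc) k) B) (m<n⇒m%n≡m (d<B 0))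
  digit-encode d (suc k) d<B d≡0 (suc u) = begin
    shift (suc u) (d 0 + r * B) % B   ≡⟨ cong (_% B) (shift-comm u (d 0 + r * B)) ⟩
    shift u ((d 0 + r * B) / B) % B   ≡⟨ cong (λ c → shift u c % B) quotient ⟩
    digit r u                         ≡⟨ digit-encode (d ∘ suc) k (d<B ∘ suc) (λ v → d≡0 (suc v) ∘ s≤s) u ⟩
    d (suc u)                         ∎
    where
    open ≡-Reasoning
    r = encode (d ∘ suc) k
    quotient : (d 0 + r * B) / B ≡ r
    quotient = begin
      (d 0 + r * B) / B      ≡⟨ +-distrib-/-∣ʳ (d 0) (divides-refl r) ⟩
      d 0 / B + r * B / B    ≡⟨ cong₂ _+_ (m<n⇒m/n≡0 (d<B 0)) (m*n/n≡m r B) ⟩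
      r                      ∎

  -- The quotient is the only `q` with `q * B ≤ c < suc q * B`, so a search for such a number finds
  -- it.
  /B-computable : Computable (_/ B)
  /B-computable =
    let q , q-rec , q-spec = minimise (
          (var 1F <ᵖ *-rec (suc-rec (var 0F)) (const-rec B)) ∧ᵖ
          (*-rec (var 0F) (const-rec B) ≤ᵖ var 1F))
          λ { (c ∷ []) → c / B , m<n*o⁺ c , m/n*n≤m c B }
    in unary (recursive-cong (λ { (c ∷ []) → ≤-antisym
         (subst (_≤ c / B) (m*n/n≡m (q (c ∷ [])) B) (/-monoˡ-≤ B (proj₂ (q-spec (c ∷ [])))))
         (s≤s⁻¹ (m<n*o⇒m/o<n {c} (proj₁ (q-spec (c ∷ []))))) }) q-rec)
    where
    m<n*o⁺ : ∀ c → c < suc (c / B) * B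
    m<n*o⁺ c = ≤-trans (s≤s (≤-reflexive (m≡m%n+[m/n]*n c B))) (+-monoˡ-≤ (c / B * B) (m%n<n c B))

  digit-rec : Recursive {2} (λ xs → digit (lookup xs 0F) (lookup xs 1F))
  digit-rec = recursive-cong (λ xs → sym (m%n≡m∸m/n*n (shift (lookup xs 1F) (lookup xs 0F)) B))
    (∸-rec shift-rec (*-rec (comp₁ (_/ B) /B-computable shift-rec) (const-rec B)))
    where
    shift-rec : Recursive {2} (λ xs → shift (lookup xs 1F) (lookup xs 0F))
    shift-rec = primrec {h = λ u xs → shift u (lookup xs 0F)} (var 0F)
      (comp₁ (_/ B) /B-computable (var 1F)) (λ _ → refl) (λ _ _ → refl) (var 1F)

bounded-lefts : ∀ (M : List Edge) → ∃[ k ] ∀ {u y} → (u , y) ∈ₗ M → u < k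
bounded-lefts [] = 0 , λ ()
bounded-lefts ((v , _) ∷ M) with k , bound ← bounded-lefts M = suc v ⊔ k , λ where
  (here refl) → m≤m⊔n (suc v) k
  (there e)   → ≤-trans (bound e) (m≤n⊔m (suc v) k)

Joins : ∀ {k} → (Fin k → ℕ → ℕ) → ℕ → ℕ → Set
Joins e u y = ∃[ i ] e i u ≡ y

-- The functions `g i` bound the left neighbours of a right vertex computably, so that the graph is
-- effectively locally finite from both sides.
module EffectiveHall
  {m} (e g : Fin (suc m) → ℕ → ℕ)
  (e-computable : ∀ i → Computable (e i)) (g-computable : ∀ i → Computable (g i))
  (preimage-≤ : ∀ i u → u ≤ g i (e i u))
  (expandsˡ : Expands (Joins e)) (expandsʳ : Expands (flip (Joins e)))
  where

  Adj : ℕ → ℕ → Set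
  Adj = Joins e

  open Digits m

  spread : ℕ → ℕ
  spread z = suc (total e z + total g z)

  -- The sum dominates every summand, hence all `e i z` and `g i z` with `z < w`. The successor in
  -- `spread` makes these bounds strict and `β` inflationary.
  β : ℕ → ℕ
  β w = Σ< w spread

  β-inflationary : ∀ w → w ≤ β w
  β-inflationary zero    = z≤n
  β-inflationary (suc w) = subst (_≤ β w + spread w) (+-comm w 1) (+-mono-≤ (β-inflationary w) (s≤s z≤n))

  e<β : ∀ i {u w} → u < w → e i u < β w
  e<β i {u} u<w = ≤-trans (s≤s (≤-trans (≤-total-sum e i u) (m≤m+n _ _))) (≤-Σ< _ spread u<w)

  g<β : ∀ i {y w} → y < w → g i y < β w
  g<β i {y} y<w = ≤-trans (s≤s (≤-trans (≤-total-sum g i y) (m≤n+m (total g y) (total e y)))) (≤-Σ< _ spread y<w)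

  left<β : ∀ {u y w} → Adj u y → y < w → u < β w
  left<β (i , refl) y<w = ≤-<-trans (preimage-≤ i _) (g<β i y<w)

  right<β : ∀ {u y w} → Adj u y → u < w → y < β w
  right<β (i , refl) = e<β i

  nbˡ nbʳ : ℕ → List ℕ
  nbˡ u = List.tabulate (λ i → e i u)
  nbʳ y = filter (λ u → mem? _≟_ y (nbˡ u)) (upTo (β (suc y)))

  nbˡ⁻ : ∀ {u y} → y ∈ₗ nbˡ u → Adj u y
  nbˡ⁻ y∈ with i , eq ← ∈-tabulate⁻ y∈ = i , sym eq

  nbˡ⁺ : ∀ {u y} → Adj u y → y ∈ₗ nbˡ u
  nbˡ⁺ {u} (i , refl) = ∈-tabulate⁺ {f = λ i → e i u} i

  nbʳ⁻ : ∀ {u y} → u ∈ₗ nbʳ y → Adj u y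
  nbʳ⁻ {u} {y} u∈ = nbˡ⁻ (proj₂ (∈-filter⁻ (λ u → mem? _≟_ y (nbˡ u)) {xs = upTo (β (suc y))} u∈))

  nbʳ⁺ : ∀ {u y} → Adj u y → u ∈ₗ nbʳ y
  nbʳ⁺ {u} {y} u~y = ∈-filter⁺ (λ u → mem? _≟_ y (nbˡ u)) (∈-upTo⁺ (left<β u~y ≤-refl)) (nbˡ⁺ u~y)

  open Cover Adj nbˡ nbʳ nbˡ⁻ nbˡ⁺ nbʳ⁻ nbʳ⁺ expandsˡ expandsʳ β β-inflationary
    (λ u~y β≤u → ≮⇒≥ λ y<w → <⇒≱ (left<β u~y y<w) β≤u) (λ u~y β≤y → ≮⇒≥ λ u<w → <⇒≱ (right<β u~y u<w) β≤y)

  -- Digit 0 of a code means unmatched, digit suc i means matched along e i.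
  target : ℕ → ℕ → ℕ
  target c u = apply e (pred (digit c u)) u

  Matched : ℕ → ℕ → ℕ → Set
  Matched c u y = digit c u ≢ 0 × target c u ≡ y

  index : ∀ c u → digit c u ≢ 0 → ∃[ i ] digit c u ≡ suc (toℕ i)
  index c u d≢0 with digit c u | digit<B c u
  ... | zero  | _       = contradiction refl d≢0
  ... | suc d | s≤s d<B = fromℕ< d<B , cong suc (sym (toℕ-fromℕ< d<B))

  target-adj : ∀ {c u} → digit c u ≢ 0 → Adj u (target c u)
  target-adj {c} {u} d≢0 with i , eq ← index c u d≢0 =
    i , trans (sym (apply-toℕ e i u)) (cong (λ d → apply e (pred d) u) (sym eq))

  -- An edge with one end below `n` has both ends below `β n`. So `β n` is the bound below which
  -- edges are frozen, and the horizon is the level that `cover-both` requires for it.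
  horizon : ℕ → ℕ
  horizon n = level β (β n) (β n)

  β≤horizon : ∀ n → β n ≤ horizon n
  β≤horizon n = go (β n)
    where
    go : ∀ i → β n ≤ level β (β n) i
    go zero    = ≤-refl
    go (suc i) = ≤-trans (go i) (≤-trans (β-inflationary _) (β-inflationary _))

  -- All quantifiers are bounded, by `c` or by the horizon, so that the search for the next stage
  -- has a recursive test.
  Valid : ℕ → ℕ → Set
  Valid n c =
    (∀ u → u < c → ∀ v → v < c → digit c u ≢ 0 → digit c v ≢ 0 → target c u ≡ target c v → u ≡ v) ×
    (∀ u → u < horizon n → digit c u ≢ 0) ×
    (∀ y → y < horizon n → ∃[ u ] u < c × Matched c u y)

  Agree : ℕ → ℕ → ℕ → Set
  Agree n c c′ = ∀ u → u < c → digit c u ≢ 0 → u < n ⊎ target c u < n → Matched c′ u (target c u)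

  module _ (M : List Edge) (M-matching : IsMatching Adj M) where

    digitOf : ∀ {u} → Dec (Lft M u) → ℕ
    digitOf (yes (_ , e)) = suc (toℕ (proj₁ (adj M-matching e)))
    digitOf (no _)        = 0

    code : ℕ
    code = encode (λ u → digitOf (Lft? M u)) (proj₁ (bounded-lefts M))

    digit-code : ∀ u → digit code u ≡ digitOf (Lft? M u)
    digit-code = digit-encode _ (proj₁ (bounded-lefts M)) (λ u → small (Lft? M u)) (λ u → vanish (Lft? M u))
      where
      small : ∀ {u} (p : Dec (Lft M u)) → digitOf p < B
      small (yes _) = s≤s (toℕ<n _)
      small (no _)  = s≤s z≤n
      vanish : ∀ {u} (p : Dec (Lft M u)) → proj₁ (bounded-lefts M) ≤ u → digitOf p ≡ 0
      vanish (yes (_ , e)) k≤u = contradiction (proj₂ (bounded-lefts M) e) (≤⇒≯ k≤u)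
      vanish (no _)        _   = refl

    code⁺ : ∀ {u y} → (u , y) ∈ₗ M → Matched code u y
    code⁺ {u} {y} uy∈M = go (Lft? M u) (digit-code u)
      where
      go : (p : Dec (Lft M u)) → digit code u ≡ digitOf p → Matched code u y
      go (no ∉M) eq = contradiction (y , uy∈M) ∉M
      go (yes (z , uz∈M)) eq with adj M-matching uz∈M
      ... | i , refl = (λ d≡0 → 0≢1+n (trans (sym d≡0) eq)) ,
        trans (cong (λ d → apply e (pred d) u) eq) (trans (apply-toℕ e i u) (functional M-matching uz∈M uy∈M))

    code⁻ : ∀ {u} → digit code u ≢ 0 → (u , target code u) ∈ₗ M
    code⁻ {u} d≢0 with Lft? M u | digit-code u
    ... | no _ | d≡0 = contradiction d≡0 d≢0
    ... | yes (y , uy∈M) | _ = subst (λ z → (u , z) ∈ₗ M) (sym (proj₂ (code⁺ uy∈M))) uy∈M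

  edges : ℕ → List Edge
  edges c = map (λ u → u , target c u) (filter (λ u → ¬? (digit c u ≟ 0)) (upTo c))

  edges⁺ : ∀ {c u y} → Matched c u y → (u , y) ∈ₗ edges c
  edges⁺ {c} {u} (d≢0 , refl) = ∈-map⁺ (λ u → u , target c u)
    (∈-filter⁺ (λ u → ¬? (digit c u ≟ 0)) (∈-upTo⁺ (digit-support c u d≢0)) d≢0)

  edges⁻ : ∀ {c u y} → (u , y) ∈ₗ edges c → Matched c u y
  edges⁻ {c} uy∈ with v , v∈ , refl ← ∈-map⁻ (λ u → u , target c u) uy∈ =
    proj₂ (∈-filter⁻ (λ u → ¬? (digit c u ≟ 0)) {xs = upTo c} v∈) , refl

  valid-injective : ∀ n {c u v y} → Valid n c → Matched c u y → Matched c v y → u ≡ v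
  valid-injective n {c} {u} {v} (inj , _) (du , refl) (dv , eq) =
    inj u (digit-support c u du) v (digit-support c v dv) du dv (sym eq)

  edges-matching : ∀ n {c} → Valid n c → IsMatching Adj (edges c)
  adj        (edges-matching n valid) uy∈ with d≢0 , refl ← edges⁻ uy∈ = target-adj d≢0
  functional (edges-matching n valid) uy∈ uz∈ = trans (sym (proj₂ (edges⁻ uy∈))) (proj₂ (edges⁻ uz∈))
  injective  (edges-matching n valid) uy∈ vy∈ = valid-injective n valid (edges⁻ uy∈) (edges⁻ vy∈)

  -- The code is turned into a list of edges, extended by `cover-both` up to the next horizon, and
  -- encoded again. The two bounds passed to `below` are the two ends of an edge that touches a
  -- vertex below `n`.
  extend : ∀ n c → Valid n c → ∃[ c′ ] Valid (suc n) c′ × Agree n c c′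
  extend n c valid@(_ , coverˡ , coverʳ)
    with M , matching , ext , M-coverˡ , M-coverʳ ← cover-both (β n) (edges-matching n valid)
           (λ u< → _ , edges⁺ (coverˡ _ u< , refl))
           (λ y< → let u , _ , uy = coverʳ _ y< in u , edges⁺ uy) (horizon (suc n)) =
    code M matching ,
    ((λ u _ v _ du dv eq → injective matching (code⁻ M matching du)
        (subst (λ z → (v , z) ∈ₗ M) (sym eq) (code⁻ M matching dv))) ,
     (λ u u< → proj₁ (code⁺ M matching (proj₂ (M-coverˡ u<)))) ,
     (λ y y< → let u , uy∈M = M-coverʳ y< ; uy = code⁺ M matching uy∈M in
        u , digit-support _ u (proj₁ uy) , uy)) ,
    λ u _ du touching → code⁺ M matching (Extends.below ext
      ([ (λ u<n → ≤-trans u<n (β-inflationary n)) , left<β (target-adj du) ]′ touching)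
      ([ right<β (target-adj du) , (λ y<n → ≤-trans y<n (β-inflationary n)) ]′ touching)
      (edges⁺ (du , refl)))

  β-computable : Computable β
  β-computable = unary (Σ<-rec (var 0F)
    (suc-rec (+-rec (comp₁ (total e) (unary (total-rec e-computable)) (var 0F))
                    (comp₁ (total g) (unary (total-rec g-computable)) (var 0F)))))

  horizon-computable : Computable horizon
  horizon-computable = unary (primrec {h = λ i xs → level β (β (lookup xs 0F)) i}
    (comp₁ β β-computable (var 0F)) (comp₁ β β-computable (comp₁ β β-computable (var 1F)))
    (λ _ → refl) (λ _ _ → refl) (comp₁ β β-computable (var 0F)))

  private variable
    k : ℕ
    a b p : Vec ℕ k → ℕ

  digit-rec′ : Recursive a → Recursive b → Recursive (λ xs → digit (a xs) (b xs))
  digit-rec′ = comp₂ digit digit-rec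

  target-rec : Recursive a → Recursive b → Recursive (λ xs → target (a xs) (b xs))
  target-rec c u = comp₂ (apply e) (apply-rec e-computable) (pred-rec (digit-rec′ c u)) u

  digit≢0ᵖ : Recursive a → Recursive b → RecursivePred (λ xs → digit (a xs) (b xs) ≢ 0)
  digit≢0ᵖ c u = ¬ᵖ (digit-rec′ c u ≡ᵖ const-rec 0)

  Matchedᵖ : Recursive a → Recursive b → Recursive p → RecursivePred (λ xs → Matched (a xs) (b xs) (p xs))
  Matchedᵖ c u y = digit≢0ᵖ c u ∧ᵖ (target-rec c u ≡ᵖ y)

  Validᵖ : RecursivePred {2} (λ xs → Valid (lookup xs 0F) (lookup xs 1F))
  Validᵖ =
    ∀<ᵖ (var 1F) (∀<ᵖ (var 2F) (digit≢0ᵖ (var 3F) (var 1F) →ᵖ digit≢0ᵖ (var 3F) (var 0F) →ᵖ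
      (target-rec (var 3F) (var 1F) ≡ᵖ target-rec (var 3F) (var 0F)) →ᵖ (var 1F ≡ᵖ var 0F))) ∧ᵖ
    ∀<ᵖ (comp₁ horizon horizon-computable (var 0F)) (digit≢0ᵖ (var 2F) (var 0F)) ∧ᵖ
    ∀<ᵖ (comp₁ horizon horizon-computable (var 0F))
      (∃<ᵖ (var 2F) (Matchedᵖ (var 3F) (var 0F) (var 1F)))

  Agreeᵖ : RecursivePred {3} (λ xs → Agree (lookup xs 1F) (lookup xs 2F) (lookup xs 0F))
  Agreeᵖ = ∀<ᵖ (var 2F) (digit≢0ᵖ (var 3F) (var 0F) →ᵖ
    ((var 0F <ᵖ var 2F) ∨ᵖ (target-rec (var 3F) (var 0F) <ᵖ var 2F)) →ᵖ
    Matchedᵖ (var 1F) (var 0F) (target-rec (var 3F) (var 0F)))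

  -- Being conditional on `Valid n c`, this can be met for every `n` and `c`, as unbounded search
  -- requires; for an invalid `c` any number will do.
  Step : ℕ → ℕ → ℕ → Set
  Step n c c′ = Valid n c → Valid (suc n) c′ × Agree n c c′

  opaque
    step : Σ[ h ∈ (Vec ℕ 2 → ℕ) ] Recursive h × (∀ xs → Step (lookup xs 0F) (lookup xs 1F) (h xs))
    step = minimise {P = λ xs → Step (lookup xs 1F) (lookup xs 2F) (lookup xs 0F)}
      (subst₂ᵖ {P = Valid} Validᵖ (var 1F) (var 2F) →ᵖ
       (subst₂ᵖ {P = Valid} Validᵖ (suc-rec (var 1F)) (var 0F) ∧ᵖ Agreeᵖ))
      λ { (n ∷ c ∷ []) → witness n c (decide (subst₂ᵖ {P = Valid} Validᵖ (var 0F) (var 1F)) (n ∷ c ∷ [])) }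
      where
      witness : ∀ n c → Dec (Valid n c) → ∃[ c′ ] Step n c c′
      witness n c (yes valid) = let c′ , ok = extend n c valid in c′ , λ _ → ok
      witness n c (no ¬valid) = 0 , λ valid → contradiction valid ¬valid

  stage : ℕ → ℕ
  stage zero    = 0
  stage (suc n) = proj₁ step (n ∷ stage n ∷ [])

  stage-computable : Computable stage
  stage-computable = unary (primrec {h = λ n _ → stage n} (const-rec 0)
    (comp₂ (λ n c → proj₁ step (n ∷ c ∷ []))
      (recursive-cong (λ { (_ ∷ _ ∷ []) → refl }) (proj₁ (proj₂ step))) (var 0F) (var 1F))
    (λ _ → refl) (λ _ _ → refl) (var 0F))

  stage-valid : ∀ n → Valid n (stage n)
  -- The empty sum gives `β 0 = 0`, hence `horizon 0 = 0`, and with the code 0 every clause is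
  -- vacuous.
  stage-valid zero    = (λ _ ()) , (λ _ ()) , (λ _ ())
  stage-valid (suc n) = proj₁ (proj₂ (proj₂ step) (n ∷ stage n ∷ []) (stage-valid n))

  stage-agree : ∀ n → Agree n (stage n) (stage (suc n))
  stage-agree n = proj₂ (proj₂ (proj₂ step) (n ∷ stage n ∷ []) (stage-valid n))

  -- By `stage-agree`, each later stage keeps the edges at vertices below `n`. Thus the partner of
  -- every vertex, left or right, is eventually constant.
  stable : ∀ {n n′ u y} → n ≤′ n′ → u < n ⊎ y < n → Matched (stage n) u y → Matched (stage n′) u y
  stable ≤′-refl _ uy = uy
  stable {n} {suc n′} (≤′-step n≤n′) small uy with d≢0 , refl ← stable n≤n′ small uy =
    stage-agree n′ _ (digit-support (stage n′) _ d≢0) d≢0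
      ([ (λ u<n → inj₁ (≤-trans u<n (≤′⇒≤ n≤n′))) , (λ y<n → inj₂ (≤-trans y<n (≤′⇒≤ n≤n′))) ]′ small)

  decided : ∀ u → digit (stage (suc u)) u ≢ 0
  decided u = proj₁ (proj₂ (stage-valid (suc u))) u (≤-trans (β-inflationary (suc u)) (β≤horizon (suc u)))

  opaque
    choice : ℕ → Fin (suc m)
    choice u = proj₁ (index (stage (suc u)) u (decided u))

    choice-computable : Computable (toℕ ∘ choice)
    choice-computable = unary (recursive-cong
      (λ xs → cong pred (proj₂ (index (stage (suc (lookup xs 0F))) (lookup xs 0F) (decided (lookup xs 0F)))))
      (pred-rec (digit-rec′ (comp₁ stage stage-computable (suc-rec (var 0F))) (var 0F))))

    choice-matched : ∀ {n} u → u < n → Matched (stage n) u (e (choice u) u)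
    choice-matched {n} u u<n = stable {suc u} {n} {u} (≤⇒≤′ u<n) (inj₁ ≤-refl) (decided u ,
      trans (cong (λ d → apply e (pred d) u) (proj₂ (index (stage (suc u)) u (decided u)))) (apply-toℕ e (choice u) u))

    choice-injective : ∀ {u v} → e (choice u) u ≡ e (choice v) v → u ≡ v
    -- At the stage `suc u + suc v` both choices are already final, and a valid stage is injective.
    choice-injective {u} {v} eq = valid-injective (suc u + suc v) (stage-valid (suc u + suc v))
      (choice-matched u (m≤m+n (suc u) (suc v)))
      (subst (Matched (stage (suc u + suc v)) v) (sym eq) (choice-matched v (m≤n+m (suc v) (suc u))))

    -- Stage `suc y` covers `y` by some `u`, possibly large. That edge is frozen on account of `y`,
    -- so it persists to a stage where the choice of `u` is final too and must agree with it.
    choice-surjective : ∀ y → ∃[ u ] e (choice u) u ≡ y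
    choice-surjective y
      with u , _ , uy ← proj₂ (proj₂ (stage-valid (suc y))) y (≤-trans (β-inflationary (suc y)) (β≤horizon (suc y))) =
      u , trans (sym (proj₂ (choice-matched {suc u + suc y} u (m≤m+n (suc u) (suc y)))))
                (proj₂ (stable {suc y} {suc u + suc y} {u} (≤⇒≤′ (m≤n+m (suc y) (suc u))) (inj₂ ≤-refl) uy))

-- Expansion from the failure of Følner's condition

lower-em : ExcludedMiddle ℓ → ExcludedMiddle 0ℓ
lower-em {ℓ} em {P} = map′ lower lift (em {Lift ℓ P})

open Inverse using (to; from; strictlyInverseˡ; strictlyInverseʳ)

boundary : List Perm → List ℕ → List ℕ
boundary R F = filter (λ x → ¬? (mem? _≟_ x F))
  (deduplicate _≟_ (concatMap (λ ρ → map (from ρ) F) (R ++ map ↔-sym R)))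

boundary-enumerates : ∀ R F → boundary R F Enumerates ∂ R (_∈ₗ F)
boundary-enumerates R F = Unique.filter⁺ ∉F? (deduplicate-! _≟_ candidates) , λ x → mk⇔ sound′ complete′
  where
  ∉F? = λ x → ¬? (mem? _≟_ x F)
  pull = λ (ρ : Perm) → map (from ρ) F
  candidates = concatMap pull (R ++ map ↔-sym R)
  sound′ : ∀ {x} → x ∈ₗ boundary R F → ∂ R (_∈ₗ F) x
  sound′ {x} x∈ with x∈′ , x∉F ← ∈-filter⁻ ∉F? {xs = deduplicate _≟_ candidates} x∈ =
    x∉F , Any.map (λ {ρ} → hit ρ) (∈-concatMap⁻ pull {xs = R ++ map ↔-sym R} (∈-deduplicate⁻ _≟_ candidates x∈′))
    where
    hit : ∀ ρ → x ∈ₗ pull ρ → to ρ x ∈ₗ F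
    hit ρ x∈ with y , y∈F , refl ← ∈-map⁻ (from ρ) x∈ = subst (_∈ₗ F) (sym (strictlyInverseˡ ρ y)) y∈F
  complete′ : ∀ {x} → ∂ R (_∈ₗ F) x → x ∈ₗ boundary R F
  complete′ {x} (x∉F , hits) = ∈-filter⁺ ∉F? (∈-deduplicate⁺ _≟_ (∈-concatMap⁺ pull
    (Any.map (λ {ρ} ρx∈F → subst (_∈ₗ pull ρ) (strictlyInverseʳ ρ x) (∈-map⁺ (from ρ) ρx∈F)) hits))) x∉F

HasSmallBoundary : List Perm → ℕ → Set
HasSmallBoundary R n =
  ∃[ F ] Unique F × F ≢ [] × ∃[ ∂F ] ∂F Enumerates ∂ R (_∈ₗ F) × n * length ∂F < length F

-- Excluded middle extracts from the failure of the condition one pair `R`, `n` that works against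
-- all non-empty finite sets; the empty set satisfies the inequality trivially.
isoperimetric : {G : Pred Perm ℓ} → ExcludedMiddle ℓ → ¬ Følner G →
  ∃[ R ] All G R × ∃[ n ] 1 ≤ n × (∀ F → Unique F → length F ≤ n * length (boundary R F))
isoperimetric {G = G} em ¬følner with em {∃[ R ] All G R × ∃[ n ] 1 ≤ n × ¬ HasSmallBoundary R n}
... | no ¬∃ = ⊥-elim (¬følner λ R R⊆G n 1≤n →
        decidable-stable (lower-em em) λ ¬small → ¬∃ (R , R⊆G , n , 1≤n , ¬small))
... | yes (R , R⊆G , n , 1≤n , ¬small) = R , R⊆G , n , 1≤n , λ where
        []      _  → z≤n
        F@(_ ∷ _) F! → ≮⇒≥ λ small → ¬small (F , F! , (λ ()) , boundary R F , boundary-enumerates R F , small)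

-- Preimages are used here because `∂` is defined by them; the theorem passes to inverses to obtain
-- images.
Spreads : List Perm → ℕ → Set
Spreads K c = ∀ F → Unique F →
  ∃[ H ] Unique H × (∀ {h} → h ∈ₗ H → ∃[ κ ] κ ∈ₗ K × to κ h ∈ₗ F) × c * length F ≤ length H

module _ {G : Pred Perm ℓ} (group : IsComputablePermGroup G)
         {R} (R⊆G : All G R) {n} (1≤n : 1 ≤ n)
         (isoperimetry : ∀ F → Unique F → length F ≤ n * length (boundary R F)) where
  open IsComputablePermGroup group
  open ≤-Reasoning

  steps : List Perm
  steps = ↔-id ℕ ∷ R ++ map ↔-sym R

  ball : ℕ → List Perm
  ball zero    = ↔-id ℕ ∷ []
  ball (suc q) = cartesianProductWith _↔-∘_ (ball q) steps

  ball⊆G : ∀ q → All G (ball q)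
  ball⊆G zero    = id-closed ∷ []
  ball⊆G (suc q) = All.cartesianProductWith⁺ (setoid Perm) (setoid Perm) _↔-∘_ (ball q) steps
    λ κ∈ ρ∈ → ∘-closed (All.lookup (ball⊆G q) κ∈) (All.lookup steps⊆G ρ∈)
    where
    steps⊆G : All G steps
    steps⊆G = id-closed ∷ All.++⁺ R⊆G (All.map⁺ (All.map ⁻¹-closed R⊆G))

  -- Passing from H to H ∪ ∂H adds at least ∣H∣ / n ≥ ∣F∣ / n points each time.
  ball-growth : ∀ q F → Unique F → ∃[ H ] Unique H ×
    (∀ {h} → h ∈ₗ H → ∃[ κ ] κ ∈ₗ ball q × to κ h ∈ₗ F) ×
    length F ≤ length H × (n + q) * length F ≤ n * length H
  ball-growth zero F F! =
    F , F! , (λ h∈F → ↔-id ℕ , here refl , h∈F) , ≤-refl , ≤-reflexive (cong (_* length F) (+-identityʳ n))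
  ball-growth (suc q) F F!
    with H , H! , reach , F≤H , growth ← ball-growth q F F! =
    H ++ boundary R H ,
    Unique.++⁺ H! (proj₁ (boundary-enumerates R H)) (λ (x∈H , x∈∂H) → proj₁ (∂-sound x∈∂H) x∈H) ,
    (λ h∈ → [ stay , move ]′ (∈-++⁻ H h∈)) ,
    ≤-trans F≤H (≤-trans (m≤m+n _ _) (≤-reflexive (sym (length-++ H)))) ,
    (begin
      (n + suc q) * length F                   ≡⟨ cong (_* length F) (+-suc n q) ⟩
      length F + (n + q) * length F            ≡⟨ +-comm (length F) _ ⟩
      (n + q) * length F + length F            ≤⟨ +-mono-≤ growth (≤-trans F≤H (isoperimetry H H!)) ⟩
      n * length H + n * length (boundary R H) ≡⟨ *-distribˡ-+ n (length H) _ ⟨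
      n * (length H + length (boundary R H))   ≡⟨ cong (n *_) (length-++ H) ⟨
      n * length (H ++ boundary R H)           ∎)
    where
    ∂-sound : ∀ {x} → x ∈ₗ boundary R H → ∂ R (_∈ₗ H) x
    ∂-sound {x} = Equivalence.to (proj₂ (boundary-enumerates R H) x)
    stay : ∀ {h} → h ∈ₗ H → ∃[ κ ] κ ∈ₗ ball (suc q) × to κ h ∈ₗ F
    stay h∈H with κ , κ∈ , κh∈F ← reach h∈H =
      κ ↔-∘ ↔-id ℕ , ∈-cartesianProductWith⁺ _↔-∘_ κ∈ (here refl) , κh∈F
    move : ∀ {h} → h ∈ₗ boundary R H → ∃[ κ ] κ ∈ₗ ball (suc q) × to κ h ∈ₗ F
    move h∈∂H with ρ , ρ∈ , ρh∈H ← find (proj₂ (∂-sound h∈∂H)) with κ , κ∈ , κρh∈F ← reach ρh∈H =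
      κ ↔-∘ ρ , ∈-cartesianProductWith⁺ _↔-∘_ κ∈ (there ρ∈) , κρh∈F

  -- With radius `3 * n` the growth factor is `n + 3 * n = 4 * n`, from which `n` cancels. Of the
  -- factor 4, one factor 2 pays for the two copies of each point and the other is the expansion.
  ball-spreads : Spreads (ball (3 * n)) 4
  ball-spreads F F! with H , H! , reach , _ , growth ← ball-growth (3 * n) F F! =
    H , H! , reach , *-cancelˡ-≤ n {{>-nonZero 1≤n}} (begin
      n * (4 * length F) ≡⟨ *-assoc n 4 (length F) ⟨
      n * 4 * length F   ≡⟨ cong (_* length F) (*-comm n 4) ⟩
      4 * n * length F   ≤⟨ growth ⟩
      n * length H       ∎)

-- Agreement of permutations at all arguments is not decidable, so excluded middle selects the
-- representatives.
distinct : ExcludedMiddle 0ℓ → (K : List Perm) → ∃[ D ]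
  AllPairs (λ π ρ → ¬ π ≈ ρ) D × (∀ {π} → π ∈ₗ D → π ∈ₗ K) × (∀ {π} → π ∈ₗ K → Any (π ≈_) D)
distinct em [] = [] , [] , (λ ()) , λ ()
distinct em (κ ∷ K) with D , D! , D⊆K , K⊆D ← distinct em K with em {Any (κ ≈_) D}
... | yes κ∈D = D , D! , there ∘ D⊆K , λ { (here refl) → κ∈D ; (there π∈K) → K⊆D π∈K }
... | no κ∉D  = κ ∷ D , All.¬Any⇒All¬ D κ∉D ∷ D! ,
  (λ { (here refl) → here refl ; (there π∈D) → there (D⊆K π∈D) }) ,
  λ { (here refl) → here (λ _ → refl) ; (there π∈K) → there (K⊆D π∈K) }

lookup-injective : ∀ {D} → AllPairs (λ π ρ → ¬ π ≈ ρ) D → Injective _≡_ _≈_ (List.lookup D)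
lookup-injective (_ ∷ _)  {zero}  {zero}  _  = refl
lookup-injective (κ∉ ∷ _) {zero}  {suc j} eq = contradiction eq (All.lookup κ∉ (∈-lookup j))
lookup-injective (κ∉ ∷ _) {suc i} {zero}  eq = contradiction (sym ∘ eq) (All.lookup κ∉ (∈-lookup i))
lookup-injective (_ ∷ D!) {suc i} {suc j} eq = cong suc (lookup-injective D! eq)

-- Subtracting from 1 passes from the convention that 0 means true to characteristic functions.
recursivePred⇒computableSet : {P : ℕ → Set} → RecursivePred {1} (λ xs → P (lookup xs 0F)) → ComputableSet P
recursivePred⇒computableSet {P} p = (λ x → 1 ∸ χ p (x ∷ [])) ,
  unary (recursive-cong (λ { (_ ∷ []) → refl }) (∸-rec (const-rec 1) (χ-rec p))) , λ x → value (decide p (x ∷ []))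
  where
  value : ∀ {x} → Dec (P x) → (x ∈ P × 1 ∸ χ p (x ∷ []) ≡ 1) ⊎ (¬ x ∈ P × 1 ∸ χ p (x ∷ []) ≡ 0)
  value (yes x∈P) = inj₁ (x∈P , cong (1 ∸_) (complete p x∈P))
  value (no x∉P)  = inj₂ (x∉P , m≤n⇒m∸n≡0 (n≢0⇒n>0 (x∉P ∘ sound p)))

-- Two copies of every point

even odd : ℕ → ℕ
even x = x * 2
odd  x = 1 + x * 2

even/2 : ∀ x → even x / 2 ≡ x
even/2 x = m*n/n≡m x 2

odd/2 : ∀ x → odd x / 2 ≡ x
odd/2 x = trans (+-distrib-/ 1 (x * 2) (s≤s (s≤s (≤-reflexive (m*n%n≡0 x 2))))) (m*n/n≡m x 2)

even-odd-disjoint : ∀ x y → even x ≢ odd y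
even-odd-disjoint x y eq = 0≢1+n (trans (sym (m*n%n≡0 x 2)) (trans (cong (_% 2) eq) ([m+kn]%n≡m%n 1 y 2)))

halve : ∀ u → u ≡ even (u / 2) ⊎ u ≡ odd (u / 2)
halve u with u % 2 | m≡m%n+[m/n]*n u 2 | m%n<n u 2
... | 0 | eq | _ = inj₁ eq
... | 1 | eq | _ = inj₂ eq
... | suc (suc _) | _ | s≤s (s≤s ())

doubled : List ℕ → List ℕ
doubled F = map even F ++ map odd F

length-doubled : ∀ F → length (doubled F) ≡ 2 * length F
length-doubled F = trans (length-++ (map even F))
  (cong₂ _+_ (length-map even F) (trans (length-map odd F) (sym (+-identityʳ _))))

doubled-unique : ∀ {F} → Unique F → Unique (doubled F)
doubled-unique F! = Unique.++⁺
  (Unique.map⁺ (λ {x} {y} → *-cancelʳ-≡ x y 2) F!)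
  (Unique.map⁺ (λ {x} {y} → *-cancelʳ-≡ x y 2 ∘ suc-injective) F!)
  λ (p , q) → let x , _ , eq = ∈-map⁻ even p ; y , _ , eq′ = ∈-map⁻ odd q in even-odd-disjoint x y (trans (sym eq) eq′)

∈-doubled⁺ : ∀ {F u} → u / 2 ∈ₗ F → u ∈ₗ doubled F
∈-doubled⁺ {F} {u} u/2∈F with halve u
... | inj₁ eq = ∈-++⁺ˡ (subst (_∈ₗ map even F) (sym eq) (∈-map⁺ even u/2∈F))
... | inj₂ eq = ∈-++⁺ʳ (map even F) (subst (_∈ₗ map odd F) (sym eq) (∈-map⁺ odd u/2∈F))

∈-doubled⁻ : ∀ {F u} → u ∈ₗ doubled F → u / 2 ∈ₗ F
∈-doubled⁻ {F} u∈ with ∈-++⁻ (map even F) u∈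
... | inj₁ p with x , x∈F , refl ← ∈-map⁻ even p = subst (_∈ₗ F) (sym (even/2 x)) x∈F
... | inj₂ p with x , x∈F , refl ← ∈-map⁻ odd p = subst (_∈ₗ F) (sym (odd/2 x)) x∈F

halved : ∀ {m} → (Fin m → Perm) → Fin m → ℕ → ℕ
halved k j u = to (k j) (u / 2)

-- Left vertices 2x and 2x + 1 are the two demands of the point x, to be
-- matched to two points of the form k x.
module Demands
  {G : Pred Perm ℓ} (group : IsComputablePermGroup G)
  {m} (k : Fin (suc m) → Perm) (k∈G : ∀ j → k j ∈ G)
  (spreads : ∀ F → Unique F → ∃[ H ] Unique H ×
             (∀ {h} → h ∈ₗ H → ∃[ x ] x ∈ₗ F × ∃[ j ] to (k j) x ≡ h) × 4 * length F ≤ length H)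
  where
  open IsComputablePermGroup group using (computable; ⁻¹-closed)

  -- The larger of the two left vertices that `k j` joins to `y`.
  bound : Fin (suc m) → ℕ → ℕ
  bound j y = odd (from (k j) y)

  preimage-≤ : ∀ j u → u ≤ bound j (halved k j u)
  preimage-≤ j u = subst (λ x → u ≤ odd x) (sym (strictlyInverseʳ (k j) (u / 2)))
    ([ (λ eq → ≤-trans (≤-reflexive eq) (n≤1+n _)) , ≤-reflexive ]′ (halve u))

  -- At most two vertices of `F` lie over each point, so the factor 4 for points leaves a factor 2
  -- for left vertices.
  expandsˡ : Expands (Joins (halved k))
  expandsˡ F F!
    with H , H! , reach , 4≤ ← spreads (deduplicate _≟_ (map (_/ 2) F)) (deduplicate-! _≟_ _) =
    H , H! , reach′ , (begin
      2 * length F        ≤⟨ *-monoʳ-≤ 2 F≤doubled ⟩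
      2 * length (doubled D) ≡⟨ cong (2 *_) (length-doubled D) ⟩
      2 * (2 * length D)  ≡⟨ *-assoc 2 2 (length D) ⟨
      4 * length D        ≤⟨ 4≤ ⟩
      length H            ∎)
    where
    open ≤-Reasoning
    D = deduplicate _≟_ (map (_/ 2) F)
    F≤doubled : length F ≤ length (doubled D)
    F≤doubled = pigeonhole _≡_ F!
      (λ u∈F → _ , ∈-doubled⁺ (∈-deduplicate⁺ _≟_ (∈-map⁺ (_/ 2) u∈F)) , refl)
      (λ p q → trans p (sym q))
    reach′ : ∀ {h} → h ∈ₗ H → ∃[ u ] u ∈ₗ F × ∃[ j ] halved k j u ≡ h
    reach′ h∈H with x , x∈D , eq ← reach h∈H
      with u , u∈F , refl ← ∈-map⁻ (_/ 2) (∈-deduplicate⁻ _≟_ (map (_/ 2) F) x∈D) = u , u∈F , eq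

  -- A single permutation suffices: both copies of the preimages of `F` under `k zero` are
  -- neighbours.
  expandsʳ : Expands (flip (Joins (halved k)))
  expandsʳ F F! = doubled (map (from (k zero)) F) ,
    doubled-unique (Unique.map⁺ (λ {x} {y} eq → trans (sym (strictlyInverseˡ (k zero) x))
      (trans (cong (to (k zero)) eq) (strictlyInverseˡ (k zero) y))) F!) ,
    reach ,
    ≤-reflexive (sym (trans (length-doubled (map (from (k zero)) F)) (cong (2 *_) (length-map (from (k zero)) F))))
    where
    reach : ∀ {u} → u ∈ₗ doubled (map (from (k zero)) F) → ∃[ y ] y ∈ₗ F × ∃[ j ] halved k j u ≡ y
    reach u∈ with y , y∈F , eq ← ∈-map⁻ (from (k zero)) (∈-doubled⁻ u∈) =
      y , y∈F , zero , trans (cong (to (k zero)) eq) (strictlyInverseˡ (k zero) y)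

  /2-computable : Computable (_/ 2)
  /2-computable = Digits./B-computable 0

  open EffectiveHall (halved k) bound
    (λ j → unary (comp₁ (to (k j)) (computable (k∈G j)) (comp₁ (_/ 2) /2-computable (var 0F))))
    (λ j → unary (suc-rec (*-rec (comp₁ (from (k j)) (computable (⁻¹-closed (k∈G j))) (var 0F)) (const-rec 2))))
    preimage-≤ expandsˡ expandsʳ
    using (choice; choice-computable; choice-injective; choice-surjective) public

-- Reading the decomposition off the matching

module Decomposition
  {G : Pred Perm ℓ} {m} (k : Fin m → Perm) (k∈G : ∀ j → k j ∈ G) (k-distinct : Injective _≡_ _≈_ k)
  (choice : ℕ → Fin m) (choice-computable : Computable (toℕ ∘ choice))
  (choice-injective : ∀ {u v} → halved k (choice u) u ≡ halved k (choice v) v → u ≡ v)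
  (choice-surjective : ∀ y → ∃[ u ] halved k (choice u) u ≡ y)
  where

  -- Each copy of ℕ is sorted by the permutation along which its points are matched. Hence `A` and
  -- `B` are partitions because `choice` is a function, and the images form one because the matching
  -- is bijective onto the right side.
  A B : Fin m → Pred ℕ 0ℓ
  A j x = choice (even x) ≡ j
  B j x = choice (odd x) ≡ j

  chosen-computable : ∀ (f : ℕ → ℕ) → Recursive {1} (λ xs → f (lookup xs 0F)) → ∀ j →
                      ComputableSet (λ x → choice (f x) ≡ j)
  chosen-computable f f-rec j = recursivePred⇒computableSet {P = λ x → choice (f x) ≡ j} record
    { χ        = χ index≡
    ; χ-rec    = χ-rec index≡
    ; sound    = λ {xs} eq → toℕ-injective (sound index≡ {xs} eq)
    ; complete = λ {xs} eq → complete index≡ {xs} (cong toℕ eq) }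
    where
    index≡ : RecursivePred (λ xs → toℕ (choice (f (lookup xs 0F))) ≡ toℕ j)
    index≡ = comp₁ (toℕ ∘ choice) choice-computable f-rec ≡ᵖ const-rec (toℕ j)

  chosen-partition : ∀ (f : ℕ → ℕ) → IsPartition (λ j x → choice (f x) ≡ j)
  chosen-partition f = record
    { covers   = λ x → choice (f x) , refl
    ; disjoint = λ j≢k (p , q) → j≢k (trans (sym p) q) }

  S : Fin m ⊎ Fin m → Pred ℕ 0ℓ
  S = [ (λ j → image (to (k j)) (A j)) , (λ j → image (to (k j)) (B j)) ]′

  -- The index `s` is recovered from the left vertex `u`, through its choice and its parity. As `y`
  -- determines `u`, it lies in one image only.
  source : ∀ s {y} → S s y → ∃[ u ] halved k (choice u) u ≡ y ×
           (s ≡ inj₁ (choice u) × u ≡ even (u / 2) ⊎ s ≡ inj₂ (choice u) × u ≡ odd (u / 2))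
  source (inj₁ j) (x , refl , refl) =
    even x , cong (to (k _)) (even/2 x) , inj₁ (refl , cong even (sym (even/2 x)))
  source (inj₂ j) (x , refl , refl) =
    odd x , cong (to (k _)) (odd/2 x) , inj₂ (refl , cong odd (sym (odd/2 x)))

  images : IsPartition S
  images = record { covers = covers ; disjoint = disjoint }
    where
    covers : ∀ y → ∃[ s ] S s y
    covers y with u , eq ← choice-surjective y with halve u
    ... | inj₁ u≡ = inj₁ (choice u) , u / 2 , cong choice (sym u≡) , eq
    ... | inj₂ u≡ = inj₂ (choice u) , u / 2 , cong choice (sym u≡) , eq
    disjoint : ∀ {s t} → s ≢ t → ∀ {y} → ¬ (S s y × S t y)
    disjoint {s} {t} s≢t (p , q) with u , eu , pu ← source s p | v , ev , pv ← source t q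
      with refl ← choice-injective {u} {v} (trans eu (sym ev)) with pu | pv
    ... | inj₁ (refl , _)  | inj₁ (refl , _)  = s≢t refl
    ... | inj₂ (refl , _)  | inj₂ (refl , _)  = s≢t refl
    ... | inj₁ (_ , even≡) | inj₂ (_ , odd≡)  = even-odd-disjoint (u / 2) (u / 2) (trans (sym even≡) odd≡)
    ... | inj₂ (_ , odd≡)  | inj₁ (_ , even≡) = even-odd-disjoint (u / 2) (u / 2) (trans (sym even≡) odd≡)

  decomposition : IsComputableParadoxicalDecomposition G k A B
  decomposition = record
    { k∈G          = k∈G
    ; k-distinct   = k-distinct
    ; A-computable = chosen-computable even (*-rec (var 0F) (const-rec 2))
    ; B-computable = chosen-computable odd (suc-rec (*-rec (var 0F) (const-rec 2)))
    ; images       = images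
    ; A-partition  = chosen-partition even
    ; B-partition  = chosen-partition odd }

theorem1 : ∀ {ℓ} → ExcludedMiddle ℓ →
    (G : Pred Perm ℓ) → IsComputablePermGroup G → ¬ Følner G →
    Σ[ m ∈ ℕ ] Σ[ k ∈ (Fin m → Perm) ]
    Σ[ A ∈ (Fin m → Pred ℕ 0ℓ) ] Σ[ B ∈ (Fin m → Pred ℕ 0ℓ) ]
    IsComputableParadoxicalDecomposition G k A B
theorem1 em G group ¬følner
  with R , R⊆G , n , 1≤n , isoperimetry ← isoperimetric em ¬følner
  -- The ball carries the points of `H` into `F`, so its inverses carry points of `F` onto those of
  -- `H`.
  with distinct (lower-em em) (map ↔-sym (ball group R⊆G 1≤n isoperimetry (3 * n)))
-- The list of permutations is not empty: the set containing only 0 already has at least four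
-- neighbours.
... | [] , _ , _ , K⊆D = ⊥-elim (nonempty (ball-spreads group R⊆G 1≤n isoperimetry (0 ∷ []) ([] ∷ [])))
  where
  nonempty : ¬ _
  nonempty ([] , _ , _ , ())
  nonempty (h ∷ _ , _ , reach , _) with _ , κ∈ , _ ← reach (here refl) with () ← K⊆D (∈-map⁺ ↔-sym κ∈)
... | D@(_ ∷ _) , D! , D⊆K , K⊆D = _ , List.lookup D , A , B , decomposition
  where
  ball⁻¹⊆G : All G (map ↔-sym (ball group R⊆G 1≤n isoperimetry (3 * n)))
  ball⁻¹⊆G = All.map⁺ (All.map (IsComputablePermGroup.⁻¹-closed group) (ball⊆G group R⊆G 1≤n isoperimetry (3 * n)))
  spreads : ∀ F → Unique F → ∃[ H ] Unique H ×
            (∀ {h} → h ∈ₗ H → ∃[ x ] x ∈ₗ F × ∃[ j ] to (List.lookup D j) x ≡ h) × 4 * length F ≤ length H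
  spreads F F! with H , H! , reach , 4≤ ← ball-spreads group R⊆G 1≤n isoperimetry F F! = H , H! , reach′ , 4≤
    where
    reach′ : ∀ {h} → h ∈ₗ H → ∃[ x ] x ∈ₗ F × ∃[ j ] to (List.lookup D j) x ≡ h
    reach′ {h} h∈H with κ , κ∈ , κh∈F ← reach h∈H with κ⁻¹∈D ← K⊆D (∈-map⁺ ↔-sym κ∈) =
      to κ h , κh∈F , Any.index κ⁻¹∈D ,
      trans (sym (lookup-index κ⁻¹∈D (to κ h))) (strictlyInverseʳ κ h)
  D⊆G : ∀ j → List.lookup D j ∈ G
  D⊆G j = All.lookup ball⁻¹⊆G (D⊆K (∈-lookup j))
  open Demands group (List.lookup D) D⊆G spreads
  open Decomposition {G = G} (List.lookup D) D⊆G (lookup-injective D!) choice choice-computable choice-injective choice-surjective
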